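{- (1) For two ATSs $K$ and $K'$ with state sets $W,W'$ and action sets $A_1,A_2$ and $A_1',A_2'$, the maximum alternating simulation relation $\preceq_{\mathsf{altsim}}$ between $K$ and $K'$ can be computed in time $$O\big(|W|\cdot|W'|\cdot|A_1|\cdot(|A_1'|\cdot|A_2'|+|A_2|)+|W|^2\cdot|A_1|+|W'|^2\cdot|A_1'|\big).$$ (2) For two TSs $K$ and $K'$ with state sets $W,W'$ and transition relations $R,R'$, the relation $\preceq_{\mathsf{altsim}}$ can be computed in time $O(|W|\cdot|R'|+|W'|\cdot|R|)$.
   Context: A labeled alternating transition system (ATS) is a tuple $K=\langle\Sigma,W,\hat w,A_1,A_2,P_1,P_2,L,\delta\rangle$ where $\Sigma$ is a finite set of observations, $W$ a finite set of states, $\hat w\in W$ the initial state, $A_i$ a finite set of actions of Agent $i$, $P_i:W\to 2^{A_i}\setminus\{\emptyset\}$ gives the non-empty set of available actions, $L:W\to\Sigma$ is a labeling, and $\delta:W\times A_1\times A_2\to W$ is the transition function; $K'=\langle\Sigma,W',\hat w',A_1',A_2',P_1',P_2',L',\delta'\rangle$ similarly. $S\subseteq W\times W'$ is an alternating simulation from $K$ to $K'$ if for all $(w,w')\in S$: $L(w)=L'(w')$, and $\forall a\in P_1(w)\ \exists a'\in P_1'(w')\ \forall b'\in P_2'(w')\ \exists b\in P_2(w):\ (\delta(w,a,b),\delta'(w',a',b'))\in S$. Alternating simulations are closed under union; $\preceq_{\mathsf{altsim}}$ denotes the maximum one. A labeled transition system (TS) is $K=\langle\Sigma,W,\hat w,R,L\rangle$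 with $R\subseteq W\times W$ such that every state has at least one successor. A TS is regarded as a special case of an ATS with $A_2=\{\bot\}$ a singleton and with $R$ described by $\delta:W\times A_1\times\{\bot\}\to W$, i.e. the $R$-successors of $w$ are the states $\delta(w,a,\bot)$, $a\in P_1(w)$. Time is counted as unit-cost operations. -}

module Defs where

open import Data.Bool.Base using (Bool; if_then_else_)
open import Data.Fin.Base using (Fin; zero; suc; toℕ)
import Data.Fin.Properties as Fin
open import Data.Fin.Subset using (Subset; Nonempty; ⊤) renaming (_∈_ to _∈ˢ_)
open import Data.Fin.Subset.Properties using (∈⊤)
open import Data.List.Base using (List; []; _∷_; length)
import Data.List.Base as List
import Data.List.Membership.DecPropositional as DecMembership
open import Data.List.Membership.Propositional using (_∈_)
import Data.List.Properties as List
open import Data.List.Relation.Unary.Unique.Propositional using (Unique)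
open import Data.Nat.Base using (ℕ; zero; suc; _+_; _∸_; _≤_)
import Data.Nat.Properties as ℕ
open import Data.Product.Base using (_×_; _,_; proj₁; proj₂; ∃; ∃-syntax)
open import Data.Product.Properties using (≡-dec)
open import Data.Vec.Base using (tabulate; lookup)
open import Data.Vec.Properties using (lookup∘tabulate; lookup⇒[]=; []=⇒lookup)
open import Level using (0ℓ)
open import Relation.Binary.Core using (REL; _⇒_)
open import Relation.Binary.Definitions using (DecidableEquality)
open import Relation.Binary.PropositionalEquality
  using (_≡_; _≢_; refl; sym; trans)
open import Relation.Nullary.Decidable using (yes; no; does; dec-true)

------------------------------------------------------------------------
-- Transition systems

-- Finite sets are Fin of their cardinality; σ is the number of
-- observations.
record ATS (σ : ℕ) : Set where
  field
    #W #A₁ #A₂ : ℕ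
    ŵ          : Fin #W
    P₁         : Fin #W → Subset #A₁
    P₂         : Fin #W → Subset #A₂
    P₁≢∅       : ∀ w → Nonempty (P₁ w)
    P₂≢∅       : ∀ w → Nonempty (P₂ w)
    L          : Fin #W → Fin σ
    δ          : Fin #W → Fin #A₁ → Fin #A₂ → Fin #W

-- R is a finite set of pairs, listed without repetition in arbitrary
-- order.
record TS (σ : ℕ) : Set where
  field
    #W     : ℕ
    ŵ      : Fin #W
    R      : List (Fin #W × Fin #W)
    unique : Unique R
    total  : ∀ w → ∃[ v ] (w , v) ∈ R
    L      : Fin #W → Fin σ

  #R : ℕ
  #R = length R

module _ {σ : ℕ} (K : TS σ) where
  open TS K
  open DecMembership (≡-dec (Fin._≟_ {#W}) (Fin._≟_ {#W})) using (_∈?_)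

  post : Fin #W → Subset #W
  post w = tabulate λ v → does ((w , v) ∈? R)

  ∈-post⁺ : ∀ {w v} → (w , v) ∈ R → v ∈ˢ post w
  ∈-post⁺ {w} {v} r = lookup⇒[]= v (post w)
    (trans (lookup∘tabulate _ v) (dec-true ((w , v) ∈? R) r))

  ∈-post⁻ : ∀ {w v} → v ∈ˢ post w → (w , v) ∈ R
  ∈-post⁻ {w} {v} p
    with (w , v) ∈? R | trans (sym (lookup∘tabulate _ v)) ([]=⇒lookup p)
  ... | yes r | _  = r
  ... | no  _ | ()

  -- An action of Agent 1 is the choice of the next state, so that
  -- A₁ = W; the successors of w are the δ w a ⊥ with a available at w
  -- by ∈-post⁺ and ∈-post⁻.
  toATS : ATS σ
  toATS = record
    { #W   = #W
    ; #A₁  = #W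
    ; #A₂  = 1
    ; ŵ    = ŵ
    ; P₁   = post
    ; P₂   = λ _ → ⊤
    ; P₁≢∅ = λ w → proj₁ (total w) , ∈-post⁺ (proj₂ (total w))
    ; P₂≢∅ = λ _ → zero , ∈⊤
    ; L    = L
    ; δ    = λ _ a _ → a
    }

------------------------------------------------------------------------
-- Alternating simulation

module _ {σ : ℕ} (K K′ : ATS σ) where
  private
    module K  = ATS K
    module K′ = ATS K′

  IsAltSim : REL (Fin K.#W) (Fin K′.#W) 0ℓ → Set
  IsAltSim S = ∀ w w′ → S w w′ →
    K.L w ≡ K′.L w′ ×
    (∀ a → a ∈ˢ K.P₁ w →
      ∃[ a′ ] a′ ∈ˢ K′.P₁ w′ ×
        (∀ b′ → b′ ∈ˢ K′.P₂ w′ →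
          ∃[ b ] b ∈ˢ K.P₂ w × S (K.δ w a b) (K′.δ w′ a′ b′)))

  IsMaximumAltSim : REL (Fin K.#W) (Fin K′.#W) 0ℓ → Set₁
  IsMaximumAltSim S =
    IsAltSim S × (∀ (T : REL (Fin K.#W) (Fin K′.#W) 0ℓ) → IsAltSim T → T ⇒ S)

------------------------------------------------------------------------
-- A unit-cost random access machine, programmed with structured control

-- A program uses finitely many named arrays.  An array cell is addressed
-- by a tuple of indices, and a scalar variable is an array addressed by
-- the empty tuple.  The only arithmetic is addition and truncated
-- subtraction.

data Region : Set where
  left right work : Region

Name : Set
Name = Region × ℕ

Cell : Set
Cell = Name × List ℕ

Store : Set
Store = Cell → ℕ

_≟ᴿ_ : DecidableEquality Region
left  ≟ᴿ left  = yes refl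
left  ≟ᴿ right = no λ ()
left  ≟ᴿ work  = no λ ()
right ≟ᴿ left  = no λ ()
right ≟ᴿ right = yes refl
right ≟ᴿ work  = no λ ()
work  ≟ᴿ left  = no λ ()
work  ≟ᴿ right = no λ ()
work  ≟ᴿ work  = yes refl

_≟ᶜ_ : DecidableEquality Cell
_≟ᶜ_ = ≡-dec (≡-dec _≟ᴿ_ ℕ._≟_) (List.≡-dec ℕ._≟_)

_[_↦_] : Store → Cell → ℕ → Store
(s [ c ↦ v ]) d = if does (d ≟ᶜ c) then v else s d

infixl 6 _⊕_ _⊖_
infix  8 _⟦_⟧

data Expr : Set where
  lit     : ℕ → Expr
  _⟦_⟧    : Name → List Expr → Expr
  _⊕_ _⊖_ : Expr → Expr → Expr

mutual
  eval : Store → Expr → ℕ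
  eval s (lit k)    = k
  eval s (x ⟦ es ⟧) = s (x , evals s es)
  eval s (e ⊕ f)    = eval s e + eval s f
  eval s (e ⊖ f)    = eval s e ∸ eval s f

  evals : Store → List Expr → List ℕ
  evals s []       = []
  evals s (e ∷ es) = eval s e ∷ evals s es

mutual
  cost : Expr → ℕ
  cost (lit k)    = 1
  cost (x ⟦ es ⟧) = 1 + costs es
  cost (e ⊕ f)    = 1 + (cost e + cost f)
  cost (e ⊖ f)    = 1 + (cost e + cost f)

  costs : List Expr → ℕ
  costs []       = 0
  costs (e ∷ es) = 1 + (cost e + costs es)

infix  5 _⟦_⟧≔_
infixr 4 _⨾_

data Program : Set where
  skip    : Program
  _⟦_⟧≔_  : Name → List Expr → Expr → Program
  _⨾_     : Program → Program → Program
  cond    : Expr → Program → Program → Program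
  while   : Expr → Program → Program

infix 3 ⟨_,_⟩⇓⟨_,_⟩

-- ⟨ p , s ⟩⇓⟨ s′ , t ⟩: started in s, p halts in s′ after t operations.
-- A test succeeds when its value is nonzero.
data ⟨_,_⟩⇓⟨_,_⟩ : Program → Store → Store → ℕ → Set where
  ⇓skip   : ∀ {s} → ⟨ skip , s ⟩⇓⟨ s , 1 ⟩
  ⇓assign : ∀ {s x es e} →
            ⟨ x ⟦ es ⟧≔ e , s ⟩⇓⟨ s [ x , evals s es ↦ eval s e ] , 1 + (costs es + cost e) ⟩
  ⇓seq    : ∀ {p q s s′ s″ t u} →
            ⟨ p , s ⟩⇓⟨ s′ , t ⟩ → ⟨ q , s′ ⟩⇓⟨ s″ , u ⟩ →
            ⟨ p ⨾ q , s ⟩⇓⟨ s″ , t + u ⟩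
  ⇓then   : ∀ {e p q s s′ t} → eval s e ≢ 0 →
            ⟨ p , s ⟩⇓⟨ s′ , t ⟩ →
            ⟨ cond e p q , s ⟩⇓⟨ s′ , 1 + (cost e + t) ⟩
  ⇓else   : ∀ {e p q s s′ t} → eval s e ≡ 0 →
            ⟨ q , s ⟩⇓⟨ s′ , t ⟩ →
            ⟨ cond e p q , s ⟩⇓⟨ s′ , 1 + (cost e + t) ⟩
  ⇓loop   : ∀ {e p s s′ s″ t u} → eval s e ≢ 0 →
            ⟨ p , s ⟩⇓⟨ s′ , t ⟩ → ⟨ while e p , s′ ⟩⇓⟨ s″ , u ⟩ →
            ⟨ while e p , s ⟩⇓⟨ s″ , 1 + (cost e + (t + u)) ⟩
  ⇓exit   : ∀ {e p s} → eval s e ≡ 0 →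
            ⟨ while e p , s ⟩⇓⟨ s , 1 + cost e ⟩

------------------------------------------------------------------------
-- Input and output

-- f extended by 0 to all indices.
at : ∀ {n} → (Fin n → ℕ) → ℕ → ℕ
at {zero}  f i       = 0
at {suc n} f zero    = f zero
at {suc n} f (suc i) = at (λ j → f (suc j)) i

bit : Bool → ℕ
bit b = if b then 1 else 0

encodeATS : ∀ {σ} → ATS σ → ℕ → List ℕ → ℕ
encodeATS {σ} K = λ where
    0 []               → σ
    1 []               → #W
    2 []               → #A₁
    3 []               → #A₂
    4 []               → toℕ ŵ
    5 (i ∷ [])         → at (λ w → toℕ (L w)) i
    6 (i ∷ j ∷ [])     → at (λ w → at (λ a → bit (lookup (P₁ w) a)) j) i
    7 (i ∷ j ∷ [])     → at (λ w → at (λ b → bit (lookup (P₂ w) b)) j) i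
    8 (i ∷ j ∷ k ∷ []) → at (λ w → at (λ a → at (λ b → toℕ (δ w a b)) k) j) i
    _ _                → 0
  where open ATS K

-- Arrays 5 and 6 hold the sources and the targets of the transitions.
encodeTS : ∀ {σ} → TS σ → ℕ → List ℕ → ℕ
encodeTS {σ} K = λ where
    0 []       → σ
    1 []       → #W
    2 []       → #R
    3 []       → toℕ ŵ
    4 (i ∷ []) → at (λ w → toℕ (L w)) i
    5 (i ∷ []) → at (λ r → toℕ (proj₁ (List.lookup R r))) i
    6 (i ∷ []) → at (λ r → toℕ (proj₂ (List.lookup R r))) i
    _ _        → 0
  where open TS K

input : (ℕ → List ℕ → ℕ) → (ℕ → List ℕ → ℕ) → Store
input f g ((left  , k) , is) = f k is
input f g ((right , k) , is) = g k is
input f g ((work  , k) , is) = 0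

output : Name
output = work , 0

outputRel : ∀ {m n} → Store → REL (Fin m) (Fin n) 0ℓ
outputRel s i j = s (output , toℕ i ∷ toℕ j ∷ []) ≡ 1

-- Started in s, p halts within B operations and leaves a relation
-- satisfying Q as a table in the output array.
_from_computes_within_ : ∀ {m n} → Program → Store →
                         (REL (Fin m) (Fin n) 0ℓ → Set₁) → ℕ → Set₁
p from s computes Q within B =
  ∃[ s′ ] ∃[ t ] ⟨ p , s ⟩⇓⟨ s′ , t ⟩ × t ≤ B × Q (outputRel s′)

{-# OPTIONS --safe #-}
module Submission where

-- The complement of the maximum alternating simulation is the least
-- solution of a system of rules "if y and z are dead then x is dead".  A
-- pair S w w′ dies if the labels differ or some action a of Agent 1 has no
-- answer.  The quantifiers are unrolled into chains: T w a v′ n dies when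
-- none of the first n actions b leads from (w , a) to an alive pair with
-- v′, and V w a w′ n dies when all of the first n actions a′ fail, where a′
-- fails as soon as T w a (δ′ w′ a′ b′) #A₂ is dead for some b′.  Going
-- through T, which depends on w′, a′ and b′ only through v′, is what makes
-- |A₂| and |A₁′|·|A₂′| add up instead of multiplying.  The rules are
-- propagated in time linear in their number: every rule is stored with both
-- premises, so that it fires when the later one is processed, and a stored
-- entry is consumed once.

open import Defs
open import Data.Bool.Base using (Bool; true; false; _∧_; _∨_; not; if_then_else_)
open import Data.Bool.Properties using (∨-conicalˡ; ∨-conicalʳ; ∧-conicalˡ; ∧-conicalʳ)
open import Data.Empty using (⊥)
open import Data.Fin.Base using (Fin; zero; suc; toℕ; fromℕ<)
import Data.Fin.Properties as Fin
open import Data.Fin.Properties using (toℕ<n; toℕ-injective; toℕ-fromℕ<; injective⇒≤)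
open import Data.Fin.Subset using () renaming (_∈_ to _∈ˢ_)
open import Data.Fin.Subset.Properties using (∈⊤)
open import Data.List.Base using (List; []; _∷_; length)
import Data.List.Base as List
open import Data.List.Membership.Propositional using (_∈_)
open import Data.List.Membership.Propositional.Properties using (∈-lookup)
open import Data.List.Properties using (∷-injective; ∷-injectiveˡ; ∷-injectiveʳ)
open import Data.List.Relation.Unary.All using (All; []; _∷_)
import Data.List.Relation.Unary.Any as Any
open import Data.List.Relation.Unary.Any.Properties using (lookup-index)
open import Data.Nat.Base
open import Data.Nat.Properties
open import Data.Nat.Tactic.RingSolver using (solve-∀)
open import Data.Product.Base using (_×_; _,_; proj₁; proj₂; ∃; ∃-syntax)
open import Data.Product.Properties using (≡-dec)
open import Data.Sum.Base using (_⊎_; inj₁; inj₂)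
open import Data.Unit.Base using (⊤; tt)
open import Data.Vec.Base using (lookup)
open import Data.Vec.Properties using (lookup⇒[]=; []=⇒lookup)
open import Function.Base using (_∘_; id; case_of_)
open import Level using (Level)
open import Relation.Binary.Definitions using (DecidableEquality; tri<; tri≈; tri>)
open import Relation.Binary.PropositionalEquality hiding (J)
open import Relation.Nullary using (¬_; Dec; yes; no; does; contradiction)
open import Relation.Nullary.Decidable using (dec-true; dec-false; ¬?; decidable-stable)
open import Relation.Unary using (_∪_)

-- Correctness is split in two. Every rule preserves `Bad`, a property of nodes that quantifies over
-- all alternating simulations, so a dead pair lies in none of them; this gives maximality.
-- Conversely the final set of dead nodes is closed under all rules, and the chains, read
-- contrapositively, yield the answers that make its complement a simulation. That set is decidable,
-- so the answers are found constructively. The linear time bound is proved without counting rules.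
-- Creating an entry or a queue position costs at least one operation, so the running time of the
-- generating program bounds both, and only its nested loops have to be estimated. The machine has
-- no multiplication and no lists. A node is therefore a five-digit number in a base `B` linear in
-- the cardinalities of the input, and tables of multiples of the powers of `B`, built in time
-- linear in `B`, make its code computable in constant time. Codes may be as large as `B ^ 5`, but
-- the arrays they address need no initialisation, since all working cells start at 0.

variable
  ℓ ℓ′ : Level

-- Stores

_≟ᴺ_ : DecidableEquality Name
_≟ᴺ_ = ≡-dec _≟ᴿ_ _≟_

update-same : ∀ s c {v} → (s [ c ↦ v ]) c ≡ v
update-same s c {v} = cong (if_then v else s c) (dec-true (c ≟ᶜ c) refl)

update-other : ∀ s c {d v} → d ≢ c → (s [ c ↦ v ]) d ≡ s d
update-other s c {d} {v} d≢c = cong (if_then v else s d) (dec-false (d ≟ᶜ c) d≢c)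

does-≟ᴺ : ∀ {x y} → does (x ≟ᴺ y) ≡ false → x ≢ y
does-≟ᴺ {x} {y} eq x≡y = case trans (sym (dec-true (x ≟ᴺ y) x≡y)) eq of λ ()

-- A Boolean, so that on a concrete program and array the side condition of `Frame` computes and is
-- discharged by `refl`.
assigns : Program → Name → Bool
assigns skip            y = false
assigns (x ⟦ _ ⟧≔ _)    y = does (y ≟ᴺ x)
assigns (p ⨾ q)         y = assigns p y ∨ assigns q y
assigns (cond _ p q)    y = assigns p y ∨ assigns q y
assigns (while _ p)     y = assigns p y

Frame : Program → Store → Store → Set
Frame p s s′ = ∀ x is → assigns p x ≡ false → s′ (x , is) ≡ s (x , is)

frame : ∀ {p s s′ t} → ⟨ p , s ⟩⇓⟨ s′ , t ⟩ → Frame p s s′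
frame ⇓skip x is eq = refl
frame {s = s} (⇓assign {x = y}) x is eq = update-other s _ (does-≟ᴺ eq ∘ cong proj₁)
frame (⇓seq {p} {q} d e) x is eq =
  trans (frame e x is (∨-conicalʳ (assigns p x) _ eq)) (frame d x is (∨-conicalˡ _ (assigns q x) eq))
frame (⇓then {q = q} _ d) x is eq = frame d x is (∨-conicalˡ _ (assigns q x) eq)
frame (⇓else {p = p} _ d) x is eq = frame d x is (∨-conicalʳ (assigns p x) _ eq)
frame (⇓loop _ d e) x is eq = trans (frame e x is eq) (frame d x is eq)
frame (⇓exit _) x is eq = refl

-- Time bounds the growth of a variable that is only ever incremented.

increment? : Name → List Expr → Expr → Bool
increment? x [] (y ⟦ [] ⟧ ⊕ lit 1) = does (x ≟ᴺ y)
increment? x _  _                  = false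

counts : Name → Program → Bool
counts x skip           = true
counts x (y ⟦ es ⟧≔ e)  = not (does (x ≟ᴺ y)) ∨ increment? x es e
counts x (p ⨾ q)        = counts x p ∧ counts x q
counts x (cond _ p q)   = counts x p ∧ counts x q
counts x (while _ p)    = counts x p

increment-≤ : ∀ x s es {e} → increment? x es e ≡ true →
              (s [ x , evals s es ↦ eval s e ]) (x , []) ≤ s (x , []) + 1
increment-≤ x s [] {z ⟦ [] ⟧ ⊕ lit 1} eq with x ≟ᴺ z in x≟z
... | yes refl = ≤-reflexive (update-same s (x , []))
... | no _     = case eq of λ ()

count-≤ : ∀ {x p s s′ t} → counts x p ≡ true → ⟨ p , s ⟩⇓⟨ s′ , t ⟩ → s′ (x , []) ≤ s (x , []) + t
count-≤ c ⇓skip = m≤m+n _ 1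
count-≤ {x} {s = s} c (⇓assign {x = y} {es} {e}) = assign (x ≟ᴺ y)
  where
  inc : x ≡ y → increment? x es e ≡ true
  inc x≡y = trans (cong (λ b → not b ∨ increment? x es e) (sym (dec-true (x ≟ᴺ y) x≡y))) c
  assign : Dec (x ≡ y) → (s [ y , evals s es ↦ eval s e ]) (x , []) ≤ s (x , []) + (1 + (costs es + cost e))
  assign (yes refl) = ≤-trans (increment-≤ x s es (inc refl)) (+-monoʳ-≤ (s (x , [])) (m≤m+n 1 _))
  assign (no x≢y)   = ≤-trans (≤-reflexive (update-other s _ (x≢y ∘ cong proj₁))) (m≤m+n _ _)
count-≤ {x} {s = s} c (⇓seq {p} {q} {t = t} {u} d e) = begin
  _                      ≤⟨ count-≤ (∧-conicalʳ (counts x p) _ c) e ⟩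
  _ + u                  ≤⟨ +-monoˡ-≤ u (count-≤ (∧-conicalˡ _ (counts x q) c) d) ⟩
  s (x , []) + t + u     ≡⟨ +-assoc (s (x , [])) t u ⟩
  s (x , []) + (t + u)   ∎
  where open ≤-Reasoning
count-≤ {x} {s = s} c (⇓then {e} {q = q} {t = t} _ d) =
  ≤-trans (count-≤ (∧-conicalˡ _ (counts x q) c) d) (+-monoʳ-≤ (s (x , [])) (m≤n+m t (1 + cost e)))
count-≤ {x} {s = s} c (⇓else {e} {p} {t = t} _ d) =
  ≤-trans (count-≤ (∧-conicalʳ (counts x p) _ c) d) (+-monoʳ-≤ (s (x , [])) (m≤n+m t (1 + cost e)))
count-≤ {x} {s = s} c (⇓loop {e} {t = t} {u} _ d f) = begin
  _                                       ≤⟨ count-≤ c f ⟩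
  _ + u                                   ≤⟨ +-monoˡ-≤ u (count-≤ c d) ⟩
  s (x , []) + t + u                      ≡⟨ +-assoc (s (x , [])) t u ⟩
  s (x , []) + (t + u)                    ≤⟨ +-monoʳ-≤ (s (x , [])) (m≤n+m (t + u) (1 + cost e)) ⟩
  s (x , []) + (1 + (cost e + (t + u)))   ∎
  where open ≤-Reasoning
count-≤ c (⇓exit _) = m≤m+n _ _

-- Total correctness with a bound on the time

Run : Program → Store → ℕ → (Store → Set ℓ) → Set ℓ
Run p s B Q = ∃[ s′ ] ∃[ t ] ⟨ p , s ⟩⇓⟨ s′ , t ⟩ × t ≤ B × Q s′

module _ {Q : Store → Set ℓ} where

  -- The frame is handed to the continuation, so that postconditions never have to list the arrays
  -- that stay unchanged.
  run-weaken : ∀ {p s B B′} {Q′ : Store → Set ℓ′} → B ≤ B′ → (∀ {s′} → Frame p s s′ → Q s′ → Q′ s′) →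
               Run p s B Q → Run p s B′ Q′
  run-weaken B≤B′ Q⇒Q′ (s′ , t , d , t≤B , q) = s′ , t , d , ≤-trans t≤B B≤B′ , Q⇒Q′ (frame d) q

  run-≤ : ∀ {p s B B′} → B ≤ B′ → Run p s B Q → Run p s B′ Q
  run-≤ B≤B′ = run-weaken B≤B′ λ _ q → q

  run-count : ∀ {p s B} x → counts x p ≡ true → Run p s B Q →
              Run p s B λ s′ → s′ (x , []) ≤ s (x , []) + B × Q s′
  run-count {s = s} x c (s′ , t , d , t≤B , q) =
    s′ , t , d , t≤B , ≤-trans (count-≤ c d) (+-monoʳ-≤ (s (x , [])) t≤B) , q

  run-skip : ∀ {s} → Q s → Run skip s 1 Q
  run-skip q = _ , _ , ⇓skip , ≤-refl , q

  run-assign : ∀ {s x es e} → Q (s [ x , evals s es ↦ eval s e ]) →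
               Run (x ⟦ es ⟧≔ e) s (1 + (costs es + cost e)) Q
  run-assign q = _ , _ , ⇓assign , ≤-refl , q

  run-seq : ∀ {p q s B C} {P : Store → Set ℓ′} → Run p s B P →
            (∀ {s′} → Frame p s s′ → P s′ → Run q s′ C Q) → Run (p ⨾ q) s (B + C) Q
  run-seq (s′ , t , d , t≤B , p) f with f (frame d) p
  ... | s″ , u , e , u≤C , q = s″ , t + u , ⇓seq d e , +-mono-≤ t≤B u≤C , q

  -- An initial assignment is executed symbolically on the store; straight-line code then needs no
  -- intermediate assertions.
  run-set : ∀ {q s x es e C} → Run q (s [ x , evals s es ↦ eval s e ]) C Q →
            Run (x ⟦ es ⟧≔ e ⨾ q) s (1 + (costs es + cost e) + C) Q
  run-set (s″ , u , e , u≤C , q) = s″ , _ , ⇓seq ⇓assign e , +-monoʳ-≤ _ u≤C , q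

  run-cond : ∀ {p q s B C} e → (eval s e ≢ 0 → Run p s B Q) → (eval s e ≡ 0 → Run q s C Q) →
             Run (cond e p q) s (1 + (cost e + (B ⊔ C))) Q
  run-cond {s = s} {B} {C} e f g with eval s e ≟ 0
  ... | no e≢0 with f e≢0
  ...   | s′ , t , d , t≤B , q =
    s′ , _ , ⇓then e≢0 d , s≤s (+-monoʳ-≤ (cost e) (≤-trans t≤B (m≤m⊔n B C))) , q
  run-cond {s = s} {B} {C} e f g | yes e≡0 with g e≡0
  ...   | s′ , t , d , t≤C , q =
    s′ , _ , ⇓else e≡0 d , s≤s (+-monoʳ-≤ (cost e) (≤-trans t≤C (m≤n⊔m B C))) , q

-- I n is an invariant whose index n decreases in every iteration.
run-while : ∀ {p s C n} e (I : ℕ → Store → Set ℓ) →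
            (∀ {n s′} → Frame p s s′ → I n s′ → eval s′ e ≢ 0 →
              Run p s′ C λ s″ → ∃[ m ] m < n × I m s″) →
            I n s → Run (while e p) s (n * (1 + (cost e + C)) + (1 + cost e))
                        λ s′ → ∃[ m ] I m s′ × eval s′ e ≡ 0
run-while {p = p} {s₀} {C} {n₀} e I step = λ i → go n₀ n₀ ≤-refl s₀ (λ _ _ _ → refl) i
  where
  -- `k` is fuel: an iteration may lower the index `n` by more than one, so the recursion cannot be
  -- structural on `n`.
  go : ∀ k n → n ≤ k → ∀ s → Frame p s₀ s → I n s →
       Run (while e p) s (n * (1 + (cost e + C)) + (1 + cost e)) λ s′ → ∃[ m ] I m s′ × eval s′ e ≡ 0
  go k n n≤k s fr i with eval s e ≟ 0
  ... | yes e≡0 = s , _ , ⇓exit e≡0 , m≤n+m _ (n * (1 + (cost e + C))) , n , i , e≡0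
  go k n n≤k s fr i | no e≢0 with step fr i e≢0
  go zero    zero    n≤k       s fr i | no e≢0 | _ , _ , _ , _ , m , () , _
  go (suc k) zero    n≤k       s fr i | no e≢0 | _ , _ , _ , _ , m , () , _
  go (suc k) (suc n) (s≤s n≤k) s fr i | no e≢0 | s′ , t , d , t≤C , m , s≤s m≤n , i′
    with go k m (≤-trans m≤n n≤k) s′ (λ x is a → trans (frame d x is a) (fr x is a)) i′
  ... | s″ , u , d′ , u≤ , q = s″ , _ , ⇓loop e≢0 d d′ , le , q
    where
    open ≤-Reasoning
    X = 1 + (cost e + C)
    le : 1 + (cost e + (t + u)) ≤ suc n * X + (1 + cost e)
    le = begin
      1 + (cost e + (t + u))                 ≤⟨ s≤s (+-monoʳ-≤ (cost e) (+-mono-≤ t≤C u≤)) ⟩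
      1 + (cost e + (C + (m * X + (1 + cost e)))) ≡⟨ cong suc (sym (+-assoc (cost e) C _)) ⟩
      X + (m * X + (1 + cost e))             ≤⟨ +-monoʳ-≤ X (+-monoˡ-≤ _ (*-monoˡ-≤ X m≤n)) ⟩
      X + (n * X + (1 + cost e))             ≡⟨ sym (+-assoc X (n * X) _) ⟩
      suc n * X + (1 + cost e)               ∎

for : Name → Name → Program → Program
for i x p = i ⟦ [] ⟧≔ lit 0 ⨾ while (x ⟦ [] ⟧ ⊖ i ⟦ [] ⟧) (p ⨾ i ⟦ [] ⟧≔ i ⟦ [] ⟧ ⊕ lit 1)

-- Each iteration adds 4 for the test and 4 for the increment to `C`. The remaining 6, for the
-- initialisation and the last test, are charged to one iteration, which exists by `1 ≤ n`.
run-for : ∀ {s C n} i x p (I : ℕ → Store → Set ℓ) →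
          assigns p i ≡ false → assigns (for i x p) x ≡ false → s (x , []) ≡ n → 1 ≤ n →
          (∀ {k s′ v} → I k s′ → I k (s′ [ i , [] ↦ v ])) →
          (∀ (k : Fin n) {s′} → Frame (for i x p) s s′ → s′ (i , []) ≡ toℕ k →
            I (toℕ k) s′ → Run p s′ C (I (suc (toℕ k)))) →
          I 0 s → Run (for i x p) s (n * (C + 14)) (I n)
run-for {s = s} {C} {n} i x p I ai ax ex 1≤n upd step i₀ =
  run-weaken bound (λ _ q → final q)
    (run-seq (run-assign {Q = J n} (0 , update-same s (i , []) , refl , upd i₀ , x-eq))
             λ fr j → run-while (x ⟦ [] ⟧ ⊖ i ⟦ [] ⟧) J (body fr) j)
  where
  body# = p ⨾ i ⟦ [] ⟧≔ i ⟦ [] ⟧ ⊕ lit 1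
  x≢i : x ≢ i
  x≢i = does-≟ᴺ (∨-conicalˡ (does (x ≟ᴺ i)) _ ax)
  x-eq : ∀ {v} → (s [ i , [] ↦ v ]) (x , []) ≡ n
  x-eq = trans (update-other s (i , []) (x≢i ∘ cong proj₁)) ex
  J : ℕ → Store → Set _
  J m s′ = ∃[ k ] s′ (i , []) ≡ k × k + m ≡ n × I k s′ × s′ (x , []) ≡ n
  body : ∀ {s₁} → Frame (i ⟦ [] ⟧≔ lit 0) s s₁ → ∀ {m s′} → Frame body# s₁ s′ → J m s′ →
         s′ (x , []) ∸ s′ (i , []) ≢ 0 → Run body# s′ (C + 4) λ s″ → ∃[ m′ ] m′ < m × J m′ s″
  body fr₀ {zero} {s′} fr (k , ek , k+m , inv , xn) ne =
    contradiction (trans (cong₂ _∸_ (trans xn (trans (sym k+m) (+-identityʳ k))) ek) (n∸n≡0 k)) ne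
  body fr₀ {suc m} {s′} fr (k , ek , k+m , inv , xn) ne =
    run-seq (run-weaken ≤-refl (λ fr′ q → fr′ , q)
              (step (fromℕ< k<n) fr-total (trans ek (sym k≡)) (subst (λ k → I k s′) (sym k≡) inv)))
      λ { {s″} _ (fr′ , inv′) → run-assign
          (m , ≤-refl , suc k , trans (update-same s″ (i , [])) (trans (+-comm _ 1) (cong suc (trans (fr′ i [] ai) ek)))
          , trans (sym (+-suc k m)) k+m
          , upd (subst (λ k → I (suc k) s″) k≡ inv′)
          , trans (update-other s″ (i , []) (x≢i ∘ cong proj₁)) (trans (fr′ x [] apx) xn)) }
    where
    k<n : k < n
    k<n = ≤-trans (m<m+n k z<s) (≤-reflexive k+m)
    k≡ : toℕ (fromℕ< k<n) ≡ k
    k≡ = toℕ-fromℕ< k<n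
    apx : assigns p x ≡ false
    apx = ∨-conicalˡ _ (does (x ≟ᴺ i)) (∨-conicalʳ (does (x ≟ᴺ i)) _ ax)
    fr-total : Frame (for i x p) s s′
    fr-total y is eq = trans (fr y is (∨-conicalʳ (does (y ≟ᴺ i)) _ eq)) (fr₀ y is (∨-conicalˡ _ _ eq))
  final : ∀ {s′} → (∃[ m ] J m s′ × s′ (x , []) ∸ s′ (i , []) ≡ 0) → I n s′
  final {s′} (m , (k , ek , k+m , inv , xn) , e0) = subst (λ k → I k s′) k≡n inv
    where
    k≡n : k ≡ n
    k≡n = ≤-antisym (≤-trans (m≤m+n k m) (≤-reflexive k+m))
            (m∸n≡0⇒m≤n (trans (sym (cong₂ _∸_ xn ek)) e0))
  bound : 2 + (n * (1 + (3 + (C + 4))) + 4) ≤ n * (C + 14)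
  bound = begin
    2 + (n * (4 + (C + 4)) + 4) ≡⟨ trans (+-comm 2 _) (+-assoc (n * (4 + (C + 4))) 4 2) ⟩
    n * (4 + (C + 4)) + 6       ≤⟨ +-monoʳ-≤ (n * (4 + (C + 4))) (*-monoˡ-≤ 6 1≤n) ⟩
    n * (4 + (C + 4)) + n * 6   ≡⟨ sym (*-distribˡ-+ n (4 + (C + 4)) 6) ⟩
    n * (4 + (C + 4) + 6)       ≡⟨ cong (n *_) (trans (cong (_+ 6) (+-comm 4 (C + 4))) (trans (+-assoc (C + 4) 4 6) (+-assoc C 4 10))) ⟩
    n * (C + 14)                ∎
    where open ≤-Reasoning

-- Positional codes

value : ℕ → List ℕ → ℕ
value B []       = 0
value B (d ∷ ds) = d * B ^ length ds + value B ds

digit-< : ∀ {d d′ P r} r′ → d < d′ → r < P → d * P + r < d′ * P + r′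
digit-< {d} {d′} {P} {r} r′ d<d′ r<P = begin-strict
  d * P + r    <⟨ +-monoʳ-< (d * P) r<P ⟩
  d * P + P    ≡⟨ +-comm (d * P) P ⟩
  suc d * P    ≤⟨ *-monoˡ-≤ P d<d′ ⟩
  d′ * P       ≤⟨ m≤m+n (d′ * P) r′ ⟩
  d′ * P + r′  ∎
  where open ≤-Reasoning

digit-≡ : ∀ {d d′ P r r′} → r < P → r′ < P → d * P + r ≡ d′ * P + r′ → d ≡ d′
digit-≡ {d} {d′} {r = r} {r′} r<P r′<P eq with <-cmp d d′
... | tri< d<d′ _ _ = contradiction eq (<⇒≢ (digit-< r′ d<d′ r<P))
... | tri≈ _ d≡d′ _ = d≡d′
... | tri> _ _ d>d′ = contradiction (sym eq) (<⇒≢ (digit-< r d>d′ r′<P))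

value-< : ∀ {B ds} → All (_< B) ds → value B ds < B ^ length ds
value-< []                       = s≤s z≤n
value-< {B} {d ∷ ds} (d<B ∷ ds<B) =
  subst (_≤ B * B ^ length ds) (+-suc (d * B ^ length ds) (value B ds))
    (≤-trans (+-monoʳ-≤ (d * B ^ length ds) (value-< ds<B))
      (≤-trans (≤-reflexive (+-comm (d * B ^ length ds) _)) (*-monoˡ-≤ (B ^ length ds) d<B)))

-- Uniqueness of the representation in base `B`; equal lengths rule out leading zeros.
value-injective : ∀ {B ds es} → length ds ≡ length es → All (_< B) ds → All (_< B) es →
                  value B ds ≡ value B es → ds ≡ es
value-injective {ds = []}     {[]}     _ _ _ _ = refl
value-injective {B} {d ∷ ds} {e ∷ es} l (_ ∷ ds<B) (_ ∷ es<B) eq = cong₂ _∷_ d≡e ds≡es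
  where
  P≡ : B ^ length es ≡ B ^ length ds
  P≡ = cong (B ^_) (sym (suc-injective l))
  eq′ : d * B ^ length ds + value B ds ≡ e * B ^ length ds + value B es
  eq′ = trans eq (cong (λ P → e * P + value B es) P≡)
  d≡e = digit-≡ {d} {e} (value-< ds<B) (≤-trans (value-< es<B) (≤-reflexive P≡)) eq′
  ds≡es : ds ≡ es
  ds≡es = value-injective (suc-injective l) ds<B es<B (+-cancelˡ-≡ (e * B ^ length ds) _ _
    (trans (cong (λ d → d * B ^ length ds + value B ds) (sym d≡e)) eq′))

-- Sums of functions of finite support

sum< : ℕ → (ℕ → ℕ) → ℕ
sum< zero    f = 0
sum< (suc N) f = f N + sum< N f

sum<-cong : ∀ N {f g : ℕ → ℕ} → (∀ u → u < N → g u ≡ f u) → sum< N g ≡ sum< N f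
sum<-cong zero    eq = refl
sum<-cong (suc N) eq = cong₂ _+_ (eq N ≤-refl) (sum<-cong N λ u u<N → eq u (m≤n⇒m≤1+n u<N))

sum<-suc : ∀ {N u f g} → u < N → g u ≡ suc (f u) → (∀ v → v ≢ u → g v ≡ f v) →
           sum< N g ≡ suc (sum< N f)
sum<-suc {suc N} {u} {f} {g} u<1+N gu eq with u ≟ N
... | yes refl = cong₂ _+_ gu (sum<-cong N λ v v<N → eq v (<⇒≢ v<N))
... | no u≢N   = trans
  (cong₂ _+_ (eq N (u≢N ∘ sym)) (sum<-suc (≤∧≢⇒< (s≤s⁻¹ u<1+N) u≢N) gu eq)) (+-suc (f N) _)

sum<-extend : ∀ N k {f} → (∀ u → N ≤ u → f u ≡ 0) → sum< (k + N) f ≡ sum< N f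
sum<-extend N zero    z = refl
sum<-extend N (suc k) z = cong₂ _+_ (z (k + N) (m≤n+m N k)) (sum<-extend N k z)

-- A sum over all of ℕ. The bound on the support is existential, so the number of entries over all
-- nodes can be tracked without any bound on the codes in use.
Total : (ℕ → ℕ) → ℕ → Set
Total f n = ∃[ N ] (∀ u → N ≤ u → f u ≡ 0) × sum< N f ≡ n

total-resp : ∀ {f g n m} → (∀ u → g u ≡ f u) → m ≡ n → Total f n → Total g m
total-resp eq m≡n (N , z , s) =
  N , (λ u N≤u → trans (eq u) (z u N≤u)) , trans (sum<-cong N λ u _ → eq u) (trans s (sym m≡n))

total-suc : ∀ {f g n} u → g u ≡ suc (f u) → (∀ v → v ≢ u → g v ≡ f v) → Total f n → Total g (suc n)
total-suc {f} {g} u gu eq (N , z , s) =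
  suc u + N , (λ v N≤v → trans (eq v (<⇒≢ (≤-trans (m≤m+n (suc u) N) N≤v) ∘ sym)) (z v (≤-trans (m≤n+m N (suc u)) N≤v))) ,
  trans (sum<-suc (m≤m+n (suc u) N) gu eq) (cong suc (trans (sum<-extend N (suc u) z) s))

total-pred : ∀ {f g n} u → g u ≡ suc (f u) → (∀ v → v ≢ u → g v ≡ f v) → Total g n →
             ∃[ m ] n ≡ suc m × Total f m
total-pred {f} {g} u gu eq (N , z , s) =
  sum< N f , trans (sym s) (sum<-suc u<N gu eq) , N , zf , refl
  where
  u<N : u < N
  u<N = ≰⇒> λ N≤u → case trans (sym gu) (z u N≤u) of λ ()
  zf : ∀ v → N ≤ v → f v ≡ 0
  zf v N≤v = trans (sym (eq v λ { refl → <⇒≱ u<N N≤v })) (z v N≤v)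

-- Memory layout

pattern queue# = work , 1
pattern qlen#  = work , 2
pattern dead#  = work , 3
pattern deg#   = work , 4
pattern adjZ#  = work , 5
pattern adjX#  = work , 6
pattern size#  = work , 7
pattern head#  = work , 8
pattern mul#   = work , 9
pattern base#  = work , 10
pattern rY     = work , 11
pattern rZ     = work , 12
pattern rX     = work , 13
pattern rT     = work , 14

queue dead deg : Store → ℕ → ℕ
queue s i = s (queue# , i ∷ [])
dead s u  = s (dead# , u ∷ [])
deg s u   = s (deg# , u ∷ [])

adjZ adjX : Store → ℕ → ℕ → ℕ
adjZ s u k = s (adjZ# , u ∷ k ∷ [])
adjX s u k = s (adjX# , u ∷ k ∷ [])

qlen : Store → ℕ
qlen s = s (qlen# , [])

Dead : Store → ℕ → Set
Dead s u = dead s u ≢ 0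

-- Registers, loop counters and `len#` are numbered from 11 on. The invariants speak only of the
-- other arrays, so they survive writes to these.
scratch : Name → Bool
scratch (work , k) = 11 ≤ᵇ k
scratch _          = false

infix 4 _≈_
_≈_ : Store → Store → Set
s ≈ s′ = ∀ x is → scratch x ≡ false → s′ (x , is) ≡ s (x , is)

scratch-update : ∀ s {c v} → scratch (proj₁ c) ≡ true → s ≈ s [ c ↦ v ]
scratch-update s sc x is eq =
  update-other s _ λ { refl → case trans (sym sc) eq of λ () }

≢-index : ∀ {x : Name} {i j : ℕ} {is} → i ≢ j → _≢_ {A = Cell} (x , i ∷ is) (x , j ∷ is)
≢-index i≢j refl = i≢j refl

-- Entry k of node u: if u and adjZ u k are dead then so is adjX u k.
Has : Store → ℕ → ℕ → ℕ → Set
Has s u z x = ∃[ k ] k < deg s u × adjZ s u k ≡ z × adjX s u k ≡ x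

-- Dead nodes and stored rules

data Item : Set where
  axiom : ℕ → Item
  rule  : ℕ → ℕ → ℕ → Item

Holds : Store → Item → Set
Holds s (axiom x)    = Dead s x
Holds s (rule y z x) = Has s y z x × Has s z y x

fire : Program
fire = cond (dead# ⟦ rX ⟦ [] ⟧ ∷ [] ⟧) skip
         ( dead# ⟦ rX ⟦ [] ⟧ ∷ [] ⟧≔ lit 1
         ⨾ queue# ⟦ qlen# ⟦ [] ⟧ ∷ [] ⟧≔ rX ⟦ [] ⟧
         ⨾ qlen# ⟦ [] ⟧≔ qlen# ⟦ [] ⟧ ⊕ lit 1)

-- `size#` is a ghost counter: it makes the number of stored entries a variable that is only
-- incremented, to which `count-≤` applies.
link : Program
link = adjZ# ⟦ rY ⟦ [] ⟧ ∷ deg# ⟦ rY ⟦ [] ⟧ ∷ [] ⟧ ∷ [] ⟧≔ rZ ⟦ [] ⟧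
     ⨾ adjX# ⟦ rY ⟦ [] ⟧ ∷ deg# ⟦ rY ⟦ [] ⟧ ∷ [] ⟧ ∷ [] ⟧≔ rX ⟦ [] ⟧
     ⨾ deg# ⟦ rY ⟦ [] ⟧ ∷ [] ⟧≔ deg# ⟦ rY ⟦ [] ⟧ ∷ [] ⟧ ⊕ lit 1
     ⨾ size# ⟦ [] ⟧≔ size# ⟦ [] ⟧ ⊕ lit 1

module Propagation (Bad : ℕ → Set₁) where

  -- Every dead node is settled (satisfies P) or waits in the queue at a
  -- position ≥ h.
  record Queue (P : ℕ → Set) (h : ℕ) (s : Store) : Set₁ where
    field
      h≤qlen      : h ≤ qlen s
      dead-bad    : ∀ u → Dead s u → Bad u
      dead-queued : ∀ u → Dead s u → P u ⊎ (∃[ i ] h ≤ i × i < qlen s × queue s i ≡ u)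
      queued-dead : ∀ i → i < qlen s → Dead s (queue s i)

  queue-resp : ∀ {P h s s′} → (∀ u → dead s′ u ≡ dead s u) → (∀ i → queue s′ i ≡ queue s i) →
               qlen s′ ≡ qlen s → Queue P h s → Queue P h s′
  queue-resp {P} {h} {s} {s′} de qe le q = record
    { h≤qlen      = subst (h ≤_) (sym le) h≤qlen
    ; dead-bad    = λ u d → dead-bad u (d ∘ trans (de u))
    ; dead-queued = λ u d → case dead-queued u (d ∘ trans (de u)) of λ
        { (inj₁ p) → inj₁ p
        ; (inj₂ (i , h≤i , i<q , eq)) → inj₂ (i , h≤i , subst (i <_) (sym le) i<q , trans (qe i) eq) }
    ; queued-dead = λ i i<q d → queued-dead i (subst (i <_) le i<q)
        (trans (sym (trans (de (queue s′ i)) (cong (dead s) (qe i)))) d)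
    }
    where open Queue q

  run-fire : ∀ {P h s} → Bad (s (rX , [])) → Queue P h s →
             Run fire s 16 λ s′ → Queue P h s′ × Dead s′ (s (rX , [])) ×
               (∀ u → Dead s u → Dead s′ u) × qlen s′ ≤ suc (qlen s)
  run-fire {P} {h} {s} bad q = run-cond (dead# ⟦ rX ⟦ [] ⟧ ∷ [] ⟧)
    (λ d → run-skip (q , d , (λ _ → id) , n≤1+n _))
    (λ d0 → run-set (run-set (run-assign (record
      { h≤qlen      = ≤-trans h≤qlen (m≤m+n l 1)
      ; dead-bad    = λ u d → case u ≟ x of λ
          { (yes refl) → bad
          ; (no u≢x) → dead-bad u (d ∘ trans (dead-other u≢x)) }
      ; dead-queued = λ u d → case u ≟ x of λ
          { (yes refl) → inj₂ (l , h≤qlen , m<m+n l z<s , update-same s₁ (queue# , l ∷ []))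
          ; (no u≢x) → case dead-queued u (d ∘ trans (dead-other u≢x)) of λ
              { (inj₁ p) → inj₁ p
              ; (inj₂ (i , h≤i , i<l , eq)) →
                  inj₂ (i , h≤i , ≤-trans i<l (m≤m+n l 1) , trans (queue-other (<⇒≢ i<l)) eq) } }
      ; queued-dead = λ i i<l → case i ≟ l of λ
          { (yes refl) → subst (Dead s₃) (sym (update-same s₁ (queue# , l ∷ []))) dead-x
          ; (no i≢l) → subst (Dead s₃) (sym (queue-other i≢l))
              (dead-mono _ (queued-dead i (≤∧≢⇒< (s≤s⁻¹ (subst (i <_) (+-comm l 1) i<l)) i≢l))) }
      } , dead-x , dead-mono , ≤-reflexive (+-comm l 1)))))
    where
    open Queue q
    x = s (rX , [])
    l = qlen s
    s₁ = s [ dead# , x ∷ [] ↦ 1 ]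
    s₂ = s₁ [ queue# , l ∷ [] ↦ x ]
    s₃ = s₂ [ qlen# , [] ↦ l + 1 ]
    dead-other : ∀ {u} → u ≢ x → dead s₃ u ≡ dead s u
    dead-other u≢x = update-other s (dead# , x ∷ []) (≢-index u≢x)
    dead-x : Dead s₃ x
    dead-x = subst (_≢ 0) (sym (update-same s (dead# , x ∷ []))) λ ()
    dead-mono : ∀ u → Dead s u → Dead s₃ u
    dead-mono u d = case u ≟ x of λ
      { (yes refl) → dead-x
      ; (no u≢x) → d ∘ trans (sym (dead-other u≢x)) }
    queue-other : ∀ {i} → i ≢ l → queue s₃ i ≡ queue s i
    queue-other i≢l = update-other s₁ (queue# , l ∷ []) (≢-index i≢l)

  -- `adj-bad` is the soundness of every stored entry; `total` ties the ghost counter to the degrees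
  -- that propagation consumes.
  record Adjacency (s : Store) : Set₁ where
    field
      adj-bad : ∀ u k → k < deg s u → Bad u → Bad (adjZ s u k) → Bad (adjX s u k)
      total   : Total (deg s) (s (size# , []))

  adjacency-resp : ∀ {s s′} → s ≈ s′ → Adjacency s → Adjacency s′
  adjacency-resp {s} {s′} eq a = record
    { adj-bad = λ u k k< bu bz → subst Bad (sym (eq _ _ refl))
        (adj-bad u k (subst (k <_) (eq _ _ refl) k<) bu (subst Bad (eq _ _ refl) bz))
    ; total   = total-resp (λ _ → eq _ _ refl) (eq _ _ refl) total
    }
    where open Adjacency a

  run-link : ∀ {s} → (Bad (s (rY , [])) → Bad (s (rZ , [])) → Bad (s (rX , []))) → Adjacency s →
             Run link s 40 λ s′ → Adjacency s′ × Has s′ (s (rY , [])) (s (rZ , [])) (s (rX , [])) ×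
               (∀ u z x → Has s u z x → Has s′ u z x)
  run-link {s} bad a = run-≤ (≤ᵇ⇒≤ _ 40 _) (run-set (run-set (run-set (run-assign
    ( record
      { adj-bad = adj-bad′
      ; total   = total-resp (λ _ → refl) (+-comm _ 1) (total-suc y deg-y (λ v → deg-other) total)
      }
    , (d , d<deg , adjZ-new , adjX-new)
    , λ { v z′ x′ (k , k< , ez , ex) →
          k , deg-mono v k< , trans (proj₁ (adj-old v k k<)) ez , trans (proj₂ (adj-old v k k<)) ex })))))
    where
    open Adjacency a
    y = s (rY , [])
    z = s (rZ , [])
    x = s (rX , [])
    d = deg s y
    s₁ = s [ adjZ# , y ∷ d ∷ [] ↦ z ]
    s₂ = s₁ [ adjX# , y ∷ d ∷ [] ↦ x ]
    s₃ = s₂ [ deg# , y ∷ [] ↦ d + 1 ]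
    s₄ = s₃ [ size# , [] ↦ s (size# , []) + 1 ]
    deg-y : deg s₄ y ≡ suc d
    deg-y = trans (update-same s₂ (deg# , y ∷ [])) (+-comm d 1)
    deg-other : ∀ {v} → v ≢ y → deg s₄ v ≡ deg s v
    deg-other v≢y = update-other s₂ (deg# , y ∷ []) (≢-index v≢y)
    deg-mono : ∀ v {k} → k < deg s v → k < deg s₄ v
    deg-mono v k< with v ≟ y
    ... | yes refl = subst (_ <_) (sym deg-y) (m<n⇒m<1+n k<)
    ... | no v≢y   = subst (_ <_) (sym (deg-other v≢y)) k<
    d<deg : d < deg s₄ y
    d<deg = ≤-reflexive (sym deg-y)
    adjZ-new : adjZ s₄ y d ≡ z
    adjZ-new = update-same s (adjZ# , y ∷ d ∷ [])
    adjX-new : adjX s₄ y d ≡ x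
    adjX-new = update-same s₁ (adjX# , y ∷ d ∷ [])
    other : ∀ v k → v ≢ y ⊎ k ≢ d → adjZ s₄ v k ≡ adjZ s v k × adjX s₄ v k ≡ adjX s v k
    other v k ne = update-other s (adjZ# , y ∷ d ∷ []) (cell-≢ ne) , update-other s₁ (adjX# , y ∷ d ∷ []) (cell-≢ ne)
      where
      cell-≢ : ∀ {x : Name} → v ≢ y ⊎ k ≢ d → _≢_ {A = Cell} (x , v ∷ k ∷ []) (x , y ∷ d ∷ [])
      cell-≢ (inj₁ v≢y) refl = v≢y refl
      cell-≢ (inj₂ k≢d) refl = k≢d refl
    adj-old : ∀ v k → k < deg s v → adjZ s₄ v k ≡ adjZ s v k × adjX s₄ v k ≡ adjX s v k
    adj-old v k k< with v ≟ y
    ... | yes refl = other v k (inj₂ (<⇒≢ k<))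
    ... | no v≢y   = other v k (inj₁ v≢y)
    adj-bad-old : ∀ v k → k < deg s v → Bad v → Bad (adjZ s₄ v k) → Bad (adjX s₄ v k)
    adj-bad-old v k k< bv bz = subst Bad (sym (proj₂ (adj-old v k k<)))
      (adj-bad v k k< bv (subst Bad (proj₁ (adj-old v k k<)) bz))
    adj-bad′ : ∀ v k → k < deg s₄ v → Bad v → Bad (adjZ s₄ v k) → Bad (adjX s₄ v k)
    adj-bad′ v k k< bv bz with v ≟ y
    ... | no v≢y = adj-bad-old v k (subst (k <_) (deg-other v≢y) k<) bv bz
    ... | yes refl with k ≟ d
    ...   | yes refl = subst Bad (sym adjX-new) (bad bv (subst Bad adjZ-new bz))
    ...   | no k≢d   = adj-bad-old v k (≤∧≢⇒< (s≤s⁻¹ (subst (k <_) deg-y k<)) k≢d) bv bz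

-- The propagation loop

solve-step : Program
solve-step =
    rY ⟦ [] ⟧≔ queue# ⟦ head# ⟦ [] ⟧ ∷ [] ⟧
  ⨾ cond (deg# ⟦ rY ⟦ [] ⟧ ∷ [] ⟧)
      ( deg# ⟦ rY ⟦ [] ⟧ ∷ [] ⟧≔ deg# ⟦ rY ⟦ [] ⟧ ∷ [] ⟧ ⊖ lit 1
      ⨾ rX ⟦ [] ⟧≔ adjX# ⟦ rY ⟦ [] ⟧ ∷ deg# ⟦ rY ⟦ [] ⟧ ∷ [] ⟧ ∷ [] ⟧
      ⨾ cond (dead# ⟦ adjZ# ⟦ rY ⟦ [] ⟧ ∷ deg# ⟦ rY ⟦ [] ⟧ ∷ [] ⟧ ∷ [] ⟧ ∷ [] ⟧) fire skip)
      (head# ⟦ [] ⟧≔ head# ⟦ [] ⟧ ⊕ lit 1)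

solve : Program
solve = while (qlen# ⟦ [] ⟧ ⊖ head# ⟦ [] ⟧) solve-step

head : Store → ℕ
head s = s (head# , [])

-- `s₀` is the store when propagation starts. Only `deg` shrinks from then on; the entries stay in
-- place, so they can be read from `s₀` throughout.
module Solving (Bad : ℕ → Set₁) (s₀ : Store) (adj₀ : Propagation.Adjacency Bad s₀) where
  open Propagation Bad
  open Adjacency adj₀

  -- Entry k of u has been consumed once deg u ≤ k.
  record Solve (n : ℕ) (s : Store) : Set₁ where
    -- The factor 2 pays for the node that consuming an entry may enqueue.
    field
      edges   : ℕ
      total′  : Total (deg s) edges
      measure : 2 * edges + (qlen s ∸ head s) ≡ n
      deg-≤   : ∀ u → deg s u ≤ deg s₀ u
      started : ∀ u → deg s u < deg s₀ u → Dead s u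
      fired   : ∀ y k l → k < deg s₀ y → l < deg s₀ (adjZ s₀ y k) →
                adjZ s₀ (adjZ s₀ y k) l ≡ y → adjX s₀ (adjZ s₀ y k) l ≡ adjX s₀ y k →
                deg s y ≤ k → deg s (adjZ s₀ y k) ≤ l → Dead s (adjX s₀ y k)
      mono    : ∀ u → Dead s₀ u → Dead s u
      waiting : Queue (λ u → deg s u ≡ 0) (head s) s

  module _ {n s} (fr : Frame solve-step s₀ s) (inv : Solve n s) (ne : qlen s ∸ head s ≢ 0) where
    open Solve inv
    open Queue waiting

    private
      Step : Program → Store → ℕ → Set₁
      Step p s C = Run p s C λ s′ → ∃[ m ] m < n × Solve m s′

      u = queue s (head s)
      head<qlen : head s < qlen s
      head<qlen = m∸n≢0⇒n<m ne
      dead-u : Dead s u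
      dead-u = queued-dead (head s) head<qlen

    -- The head moves on only when its node has no entries left, that is, when the node has become
    -- settled.
    next : deg s u ≡ 0 → Step (head# ⟦ [] ⟧≔ head# ⟦ [] ⟧ ⊕ lit 1) (s [ rY , [] ↦ u ]) 4
    next deg0 = run-assign (_ , m<n , record
      { edges = edges ; total′ = total′ ; measure = refl
      ; deg-≤ = deg-≤ ; started = started ; fired = fired ; mono = mono
      ; waiting = record
        { h≤qlen = subst (_≤ qlen s) (+-comm 1 (head s)) head<qlen
        ; dead-bad = dead-bad
        ; dead-queued = λ v d → case dead-queued v d of λ
            { (inj₁ p) → inj₁ p
            ; (inj₂ (i , h≤i , i<q , eq)) → case head s ≟ i of λ
                { (yes refl) → inj₁ (subst (λ v → deg s v ≡ 0) eq deg0)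
                ; (no h≢i) → inj₂ (i , subst (_≤ i) (+-comm 1 (head s)) (≤∧≢⇒< h≤i h≢i) , i<q , eq) } }
        ; queued-dead = queued-dead
        }
      })
      where
      m<n : 2 * edges + (qlen s ∸ (head s + 1)) < n
      m<n = subst (2 * edges + (qlen s ∸ (head s + 1)) <_) measure
        (+-monoʳ-< (2 * edges) (∸-monoʳ-< (m<m+n (head s) z<s) (subst (_≤ qlen s) (+-comm 1 (head s)) head<qlen)))

    -- Both outcomes of the test on the second premise meet here: `s₁` is the store without the
    -- entry, `s₂` the store after a possible `fire`. `fire-x` is conditional, so it holds vacuously
    -- when nothing was fired.
    module _ {k s₁ s₂} (deg-u : deg s u ≡ suc k) (s₁-deg-u : deg s₁ u ≡ k)
             (s₁-deg : ∀ v → v ≢ u → deg s₁ v ≡ deg s v) (fr₁ : Frame fire s₁ s₂)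
             (head-≡ : head s₁ ≡ head s) (qlen-≤ : qlen s₂ ≤ suc (qlen s))
             (dead-mono : ∀ v → Dead s v → Dead s₂ v)
             (fire-x : Dead s (adjZ s₀ u k) → Dead s₂ (adjX s₀ u k))
             (waiting₂ : Queue (λ v → deg s₁ v ≡ 0) (head s) s₂) where

      private
        deg₂-u : deg s₂ u ≡ k
        deg₂-u = trans (fr₁ _ _ refl) s₁-deg-u
        deg₂ : ∀ v → v ≢ u → deg s₂ v ≡ deg s v
        deg₂ v v≢u = trans (fr₁ _ _ refl) (s₁-deg v v≢u)
        deg₂-≤ : ∀ v → deg s₂ v ≤ deg s v
        deg₂-≤ v with v ≟ u
        ... | yes refl = ≤-trans (≤-reflexive deg₂-u) (≤-trans (n≤1+n k) (≤-reflexive (sym deg-u)))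
        ... | no v≢u   = ≤-reflexive (deg₂ v v≢u)
        handled-dead : ∀ v l → deg s₂ v ≤ l → l < deg s₀ v → Dead s v
        handled-dead v l d≤l l< with v ≟ u
        ... | yes refl = dead-u
        ... | no v≢u   = started v (≤-trans (s≤s (subst (_≤ l) (deg₂ v v≢u) d≤l)) l<)
        consumed : ∀ v l → deg s₂ v ≤ l → deg s v ≰ l → v ≡ u × l ≡ k
        consumed v l ≤l ≰l with v ≟ u
        ... | yes refl = refl , ≤-antisym (s≤s⁻¹ (subst (l <_) deg-u (≰⇒> ≰l))) (subst (_≤ l) deg₂-u ≤l)
        ... | no v≢u   = contradiction (subst (_≤ l) (deg₂ v v≢u) ≤l) ≰l
        -- Only a rule one of whose two copies is the entry consumed now is new. The node holding
        -- the other copy has then lost that copy too, and only dead nodes lose entries; so the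
        -- second premise is dead and `fire-x` applies. If both premises are `u`, the second one is
        -- dead as `u` itself is.
        fired₂ : ∀ y k l → k < deg s₀ y → l < deg s₀ (adjZ s₀ y k) →
                 adjZ s₀ (adjZ s₀ y k) l ≡ y → adjX s₀ (adjZ s₀ y k) l ≡ adjX s₀ y k →
                 deg s₂ y ≤ k → deg s₂ (adjZ s₀ y k) ≤ l → Dead s₂ (adjX s₀ y k)
        fired₂ y k′ l k< l< ez ex y≤ z≤ with deg s y ≤? k′ | deg s (adjZ s₀ y k′) ≤? l
        ... | yes y≤′ | yes z≤′ = dead-mono _ (fired y k′ l k< l< ez ex y≤′ z≤′)
        ... | no y≰ | _ with consumed y k′ y≤ y≰
        ...   | refl , refl = fire-x (handled-dead (adjZ s₀ u k) l z≤ l<)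
        fired₂ y k′ l k< l< ez ex y≤ z≤ | yes _ | no z≰ with consumed (adjZ s₀ y k′) l z≤ z≰
        ... | z≡u , refl = subst (Dead s₂) (trans (cong (λ v → adjX s₀ v k) (sym z≡u)) ex)
          (fire-x (subst (Dead s) (trans (sym ez) (cong (λ v → adjZ s₀ v k) z≡u)) (handled-dead y k′ y≤ k<)))

      consume : ∃[ m ] m < n × Solve m s₂
      consume with total-pred {deg s₂} {deg s} u (trans deg-u (cong suc (sym deg₂-u))) (λ v v≢u → sym (deg₂ v v≢u)) total′
      ... | m , refl , tot = _ , m<n , record
        { edges = m ; total′ = tot ; measure = refl
        ; deg-≤ = λ v → ≤-trans (deg₂-≤ v) (deg-≤ v)
        ; started = λ v d< → dead-mono v (handled-dead v (deg s₂ v) ≤-refl d<)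
        ; fired = fired₂
        ; mono = λ v → dead-mono v ∘ mono v
        ; waiting = record
          { h≤qlen = subst (_≤ qlen s₂) (sym head₂) (Queue.h≤qlen waiting₂)
          ; dead-bad = Queue.dead-bad waiting₂
          ; dead-queued = λ v d → case Queue.dead-queued waiting₂ v d of λ
              { (inj₁ p) → inj₁ (trans (fr₁ _ _ refl) p)
              ; (inj₂ (i , h≤i , r)) → inj₂ (i , subst (_≤ i) (sym head₂) h≤i , r) }
          ; queued-dead = Queue.queued-dead waiting₂
          }
        }
        where
        head₂ : head s₂ ≡ head s
        head₂ = trans (fr₁ _ _ refl) head-≡
        open ≤-Reasoning
        m<n : 2 * m + (qlen s₂ ∸ head s₂) < n
        m<n = begin-strict
          2 * m + (qlen s₂ ∸ head s₂)         ≡⟨ cong (λ h → 2 * m + (qlen s₂ ∸ h)) head₂ ⟩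
          2 * m + (qlen s₂ ∸ head s)          ≤⟨ +-monoʳ-≤ (2 * m) (∸-monoˡ-≤ (head s) qlen-≤) ⟩
          2 * m + (suc (qlen s) ∸ head s)     ≡⟨ cong (2 * m +_) (+-∸-assoc 1 (<⇒≤ head<qlen)) ⟩
          2 * m + suc (qlen s ∸ head s)       ≡⟨ +-suc (2 * m) _ ⟩
          suc (2 * m + (qlen s ∸ head s))     <⟨ n<1+n _ ⟩
          2 + 2 * m + (qlen s ∸ head s)       ≡⟨ cong (_+ (qlen s ∸ head s)) (sym (*-suc 2 m)) ⟩
          2 * suc m + (qlen s ∸ head s)       ≡⟨ measure ⟩
          n                                   ∎

    run-solve-step : Step solve-step s 80
    run-solve-step = run-≤ (≤ᵇ⇒≤ _ 80 _) (run-set {C = 60} (run-≤ (≤ᵇ⇒≤ _ 60 _) (run-cond (deg# ⟦ rY ⟦ [] ⟧ ∷ [] ⟧) busy next)))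
      where
      busy : deg s u ≢ 0 → Step
        ( deg# ⟦ rY ⟦ [] ⟧ ∷ [] ⟧≔ deg# ⟦ rY ⟦ [] ⟧ ∷ [] ⟧ ⊖ lit 1
        ⨾ rX ⟦ [] ⟧≔ adjX# ⟦ rY ⟦ [] ⟧ ∷ deg# ⟦ rY ⟦ [] ⟧ ∷ [] ⟧ ∷ [] ⟧
        ⨾ cond (dead# ⟦ adjZ# ⟦ rY ⟦ [] ⟧ ∷ deg# ⟦ rY ⟦ [] ⟧ ∷ [] ⟧ ∷ [] ⟧ ∷ [] ⟧) fire skip)
        (s [ rY , [] ↦ u ]) _
      busy deg≢0 = run-set (run-set {C = 30} (run-≤ (≤ᵇ⇒≤ _ 30 _) (run-cond _
        (λ dead-z → run-weaken ≤-refl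
          (λ { {s₂} fr₁ (q , dx , mono₁ , q≤) → consume deg-u deg₁-u deg₁ fr₁ refl q≤ mono₁
                 (λ _ → subst (Dead s₂) x≡ dx) q })
          (run-fire (bad-x (subst (Dead s) z≡ dead-z)) waiting₁))
        (λ dead-z0 → run-skip (consume deg-u deg₁-u deg₁ (λ _ _ _ → refl) refl (n≤1+n _) (λ _ → id)
          (λ d → contradiction (trans (cong (dead s) (sym z≡)) dead-z0) d) waiting₁)))))
        where
        k = pred (deg s u)
        deg-u : deg s u ≡ suc k
        deg-u = sym (suc-pred (deg s u) ⦃ ≢-nonZero deg≢0 ⦄)
        s′ = s [ rY , [] ↦ u ]
        s″ = s′ [ deg# , u ∷ [] ↦ deg s u ∸ 1 ]
        deg₁-u : deg s″ u ≡ k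
        deg₁-u = trans (update-same s′ (deg# , u ∷ [])) (cong (_∸ 1) deg-u)
        deg₁ : ∀ v → v ≢ u → deg s″ v ≡ deg s v
        deg₁ v v≢u = update-other s′ (deg# , u ∷ []) (≢-index v≢u)
        x≡ : adjX s u (deg s″ u) ≡ adjX s₀ u k
        x≡ = trans (cong (adjX s u) deg₁-u) (fr _ _ refl)
        z≡ : adjZ s u (deg s″ u) ≡ adjZ s₀ u k
        z≡ = trans (cong (adjZ s u) deg₁-u) (fr _ _ refl)
        s‴ = s″ [ rX , [] ↦ adjX s u (deg s″ u) ]
        bad-x : Dead s (adjZ s₀ u k) → Bad (s‴ (rX , []))
        bad-x dz = subst Bad (sym x≡) (adj-bad u k (≤-trans (≤-reflexive (sym deg-u)) (deg-≤ u))
          (dead-bad u dead-u) (dead-bad _ dz))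
        waiting₁ : Queue (λ v → deg s‴ v ≡ 0) (head s) s‴
        waiting₁ = record
          { h≤qlen = h≤qlen ; dead-bad = dead-bad ; queued-dead = queued-dead
          ; dead-queued = λ v d → case dead-queued v d of λ
              { (inj₁ p) → inj₁ (trans (deg₁ v (λ { refl → case trans (sym deg-u) p of λ () })) p)
              ; (inj₂ r) → inj₂ r }
          }

  run-solve : head s₀ ≡ 0 → Queue (λ _ → ⊥) 0 s₀ →
              Run solve s₀ ((2 * s₀ (size# , []) + qlen s₀) * 84 + 4) λ s →
                (∀ u → Dead s u → Bad u) × (∀ u → Dead s₀ u → Dead s u) ×
                (∀ y z x → Holds s₀ (rule y z x) → Dead s y → Dead s z → Dead s x)
  run-solve head0 q₀ = run-weaken ≤-refl (λ _ → final) (run-while (qlen# ⟦ [] ⟧ ⊖ head# ⟦ [] ⟧) Solve run-solve-step initial)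
    where
    open Queue q₀
    initial : Solve (2 * s₀ (size# , []) + qlen s₀) s₀
    initial = record
      { edges = s₀ (size# , []) ; total′ = total ; measure = cong (λ h → 2 * s₀ (size# , []) + (qlen s₀ ∸ h)) head0
      ; deg-≤ = λ _ → ≤-refl
      ; started = λ _ lt → contradiction lt (<-irrefl refl)
      ; fired = λ _ _ _ k< _ _ _ ≤k _ → contradiction ≤k (<⇒≱ k<)
      ; mono = λ _ → id
      ; waiting = record
        { h≤qlen = ≤-trans (≤-reflexive head0) z≤n
        ; dead-bad = dead-bad ; queued-dead = queued-dead
        ; dead-queued = λ v d → case dead-queued v d of λ
            { (inj₂ (i , _ , r)) → inj₂ (i , ≤-trans (≤-reflexive head0) z≤n , r) }
        }
      }
    final : ∀ {s} → (∃[ m ] Solve m s × qlen s ∸ head s ≡ 0) →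
            (∀ u → Dead s u → Bad u) × (∀ u → Dead s₀ u → Dead s u) ×
            (∀ y z x → Holds s₀ (rule y z x) → Dead s y → Dead s z → Dead s x)
    final {s} (m , inv , empty) = Queue.dead-bad waiting , mono , closed
      where
      open Solve inv
      -- With the queue empty every dead node is settled, so both copies of a rule with dead
      -- premises have been consumed and `fired` applies.
      deg0 : ∀ u → Dead s u → deg s u ≡ 0
      deg0 u d = case Queue.dead-queued waiting u d of λ
        { (inj₁ p) → p
        ; (inj₂ (i , h≤i , i<q , _)) → contradiction (m∸n≡0⇒m≤n empty) (<⇒≱ (≤-trans (s≤s h≤i) i<q)) }
      closed : ∀ y z x → Holds s₀ (rule y z x) → Dead s y → Dead s z → Dead s x
      closed y z x ((k , k< , refl , refl) , (l , l< , ez , ex)) dy dz =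
        fired y k l k< l< ez ex (subst (_≤ k) (sym (deg0 y dy)) z≤n) (subst (_≤ l) (sym (deg0 z dz)) z≤n)

-- Node codes: row d of mul# lists the multiples of B ^ d, since the machine
-- cannot multiply.

node : List Expr → Expr
node []       = lit 0
node (e ∷ es) = mul# ⟦ lit (length es) ∷ e ∷ [] ⟧ ⊕ node es

Table : ℕ → ℕ → Store → Set
Table B D s = ∀ d i → d < D → i ≤ B → s (mul# , d ∷ i ∷ []) ≡ i * B ^ d

length-evals : ∀ s es → length (evals s es) ≡ length es
length-evals s []       = refl
length-evals s (e ∷ es) = cong suc (length-evals s es)

eval-node : ∀ {B D s} es → Table B D s → length es ≤ D → All (_< B) (evals s es) →
            eval s (node es) ≡ value B (evals s es)
eval-node []           tbl len []        = refl
eval-node {B} {s = s} (e ∷ es) tbl len (e<B ∷ es<B) = cong₂ _+_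
  (trans (tbl (length es) (eval s e) len (<⇒≤ e<B)) (cong (λ l → eval s e * B ^ l) (sym (length-evals s es))))
  (eval-node es tbl (<⇒≤ len) es<B)

-- Entry `B` of row `d` is `B ^ suc d`, the step of the next row. This is why a row runs up to index
-- `B` inclusive although digits stay below `B`.
row-step : ℕ → Expr
row-step zero    = lit 1
row-step (suc d) = mul# ⟦ lit d ∷ base# ⟦ [] ⟧ ∷ [] ⟧

row-body : ℕ → Program
row-body d = mul# ⟦ lit d ∷ rY ⟦ [] ⟧ ⊕ lit 1 ∷ [] ⟧≔ mul# ⟦ lit d ∷ rY ⟦ [] ⟧ ∷ [] ⟧ ⊕ row-step d

row : ℕ → Program
row d = for rY base# (row-body d)

tables : ℕ → Program
tables zero    = skip
tables (suc d) = tables d ⨾ row d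

-- Rows ≥ d of the table are still untouched.
Rows : ℕ → ℕ → Store → Set
Rows B d s = Table B d s × (∀ d′ i → d ≤ d′ → s (mul# , d′ ∷ i ∷ []) ≡ 0) × s (base# , []) ≡ B

cost-row-step : ∀ d → cost (row-step d) ≤ 5
cost-row-step zero    = s≤s z≤n
cost-row-step (suc d) = ≤-refl

eval-row-step : ∀ {B s} d → Table B d s → s (base# , []) ≡ B → eval s (row-step d) ≡ B ^ d
eval-row-step         zero    tbl base = refl
eval-row-step {B} {s} (suc d) tbl base =
  trans (cong (λ b → s (mul# , d ∷ b ∷ [])) base) (tbl d B ≤-refl ≤-refl)

run-row : ∀ {B s} d → 1 ≤ B → Rows B d s → Run (row d) s (B * 40) (Rows B (suc d))
run-row {B} {s} d 1≤B (tbl , zeros , base) =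
  run-weaken ≤-refl (λ {s′} _ → done {s′})
    (run-for rY base# (row-body d) I refl refl base 1≤B id (λ k {s′} _ → step k {s′}) start)
  where
  Other : Store → Set
  Other s′ = ∀ d′ i → d′ ≢ d → s′ (mul# , d′ ∷ i ∷ []) ≡ s (mul# , d′ ∷ i ∷ [])
  I : ℕ → Store → Set
  I k s′ = s′ (base# , []) ≡ B × Other s′ × (∀ i → i ≤ k → s′ (mul# , d ∷ i ∷ []) ≡ i * B ^ d)
  table′ : ∀ {s′} → Other s′ → Table B d s′
  table′ oth d′ i d′<d i≤B = trans (oth d′ i (<⇒≢ d′<d)) (tbl d′ i d′<d i≤B)
  start : I 0 s
  start = base , (λ _ _ _ → refl) , λ { zero z≤n → zeros d 0 ≤-refl }
  step : ∀ (k : Fin B) {s′} → s′ (rY , []) ≡ toℕ k → I (toℕ k) s′ → Run (row-body d) s′ 26 (I (suc (toℕ k)))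
  step k {s′} ek (base′ , oth , done) = run-≤ bound (run-assign {s = s′}
    ( base′
    , (λ d′ i d′≢d → trans (update-other s′ cell (λ { refl → d′≢d refl })) (oth d′ i d′≢d))
    , λ i i≤ → case i ≟ s′ (rY , []) + 1 of λ
        { (yes refl) → trans (update-same s′ cell) new
        ; (no i≢) → trans (update-other s′ cell (λ { refl → i≢ refl }))
            (done i (s≤s⁻¹ (≤∧≢⇒< i≤ (λ i≡ → i≢ (trans i≡ (trans (cong suc (sym ek)) (+-comm 1 _)))))))}))
    where
    cell : Cell
    cell = mul# , d ∷ s′ (rY , []) + 1 ∷ []
    bound : 1 + (6 + (6 + cost (row-step d))) ≤ 26
    bound = s≤s (+-monoʳ-≤ 6 (≤-trans (+-monoʳ-≤ 6 (cost-row-step d)) (≤ᵇ⇒≤ 11 19 _)))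
    new : s′ (mul# , d ∷ s′ (rY , []) ∷ []) + eval s′ (row-step d) ≡ (s′ (rY , []) + 1) * B ^ d
    new = begin
      _                             ≡⟨ cong₂ _+_ (done _ (≤-reflexive ek)) (eval-row-step {s = s′} d (table′ {s′} oth) base′) ⟩
      s′ (rY , []) * B ^ d + B ^ d  ≡⟨ +-comm _ (B ^ d) ⟩
      suc (s′ (rY , [])) * B ^ d    ≡⟨ cong (_* B ^ d) (+-comm 1 (s′ (rY , []))) ⟩
      (s′ (rY , []) + 1) * B ^ d    ∎
      where open ≡-Reasoning
  done : ∀ {s′} → I B s′ → Rows B (suc d) s′
  done {s′} (base′ , oth , new) = tbl′ , (λ d′ i d<d′ → trans (oth d′ i (<⇒≢ d<d′ ∘ sym)) (zeros d′ i (<⇒≤ d<d′))) , base′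
    where
    tbl′ : Table B (suc d) s′
    tbl′ d′ i d′<1+d i≤B with d′ ≟ d
    ... | yes refl = new i i≤B
    ... | no d′≢d  = table′ {s′} oth d′ i (≤∧≢⇒< (s≤s⁻¹ d′<1+d) d′≢d) i≤B

run-tables : ∀ {B s} d → 1 ≤ B → Rows B 0 s → Run (tables d) s (1 + d * (B * 40)) (Rows B d)
run-tables         zero    1≤B r = run-skip r
run-tables {B}     (suc d) 1≤B r =
  run-≤ (s≤s (≤-reflexive (+-comm (d * (B * 40)) (B * 40)))) (run-seq (run-tables d 1≤B r) λ _ → run-row d 1≤B)

init : Expr → Program
init e = base# ⟦ [] ⟧≔ e ⨾ tables 5

run-init : ∀ {f g} e → let B = eval (input f g) e in 1 ≤ B →
           Run (init e) (input f g) (1 + cost e + (1 + 5 * (B * 40))) (Table B 5)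
run-init e 1≤B = run-set (run-weaken ≤-refl (λ _ → proj₁)
  (run-tables 5 1≤B ((λ _ _ ()) , (λ _ _ _ → refl) , refl)))

-- Writing out the pairs that stay alive

loop-i loop-j : Name
loop-i = work , 21
loop-j = work , 22

coords : List Expr
coords = lit 0 ∷ loop-i ⟦ [] ⟧ ∷ loop-j ⟦ [] ⟧ ∷ lit 0 ∷ lit 0 ∷ []

write : Program
write = output ⟦ loop-i ⟦ [] ⟧ ∷ loop-j ⟦ [] ⟧ ∷ [] ⟧≔
          lit 1 ⊖ dead# ⟦ node coords ∷ [] ⟧

-- Array 1 is the number of states in both encodings, so one program serves both parts of the
-- theorem.
report : Program
report = for loop-i (left , 1) (for loop-j (right , 1) write)

-- Programs that generate rules

-- `imply` overwrites these cells while it is still evaluating its operands; expressions that avoid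
-- them keep their values.
register : Name → Bool
register (work , k) = (11 ≤ᵇ k) ∧ (k ≤ᵇ 14)
register _          = false

mutual
  stable : Expr → Bool
  stable (lit _)    = true
  stable (x ⟦ es ⟧) = not (register x) ∧ stables es
  stable (e ⊕ f)    = stable e ∧ stable f
  stable (e ⊖ f)    = stable e ∧ stable f

  stables : List Expr → Bool
  stables []       = true
  stables (e ∷ es) = stable e ∧ stables es

module _ {s s′ : Store} (eq : ∀ x is → register x ≡ false → s′ (x , is) ≡ s (x , is)) where mutual

  eval-stable : ∀ e → stable e ≡ true → eval s′ e ≡ eval s e
  eval-stable (lit _)    st = refl
  eval-stable (x ⟦ es ⟧) st with register x in r
  ... | false = trans (eq x _ r) (cong (λ is → s (x , is)) (evals-stable es st))
  eval-stable (e ⊕ f) st = cong₂ _+_ (eval-stable e (∧-conicalˡ _ _ st)) (eval-stable f (∧-conicalʳ (stable e) _ st))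
  eval-stable (e ⊖ f) st = cong₂ _∸_ (eval-stable e (∧-conicalˡ _ _ st)) (eval-stable f (∧-conicalʳ (stable e) _ st))

  evals-stable : ∀ es → stables es ≡ true → evals s′ es ≡ evals s es
  evals-stable []       st = refl
  evals-stable (e ∷ es) st = cong₂ _∷_ (eval-stable e (∧-conicalˡ _ _ st)) (evals-stable es (∧-conicalʳ (stable e) _ st))

update-≢ : ∀ s {y v} x is → register y ≡ true → register x ≡ false → (s [ y , [] ↦ v ]) (x , is) ≡ s (x , is)
update-≢ s x is ry rx = update-other s _ λ { refl → case trans (sym ry) rx of λ () }

mark : List Expr → Program
mark es = rX ⟦ [] ⟧≔ node es ⨾ fire

imply : List Expr → List Expr → List Expr → Program
imply ys zs xs =
    rY ⟦ [] ⟧≔ node ys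
  ⨾ rZ ⟦ [] ⟧≔ node zs
  ⨾ rX ⟦ [] ⟧≔ node xs
  ⨾ link
  ⨾ rT ⟦ [] ⟧≔ rY ⟦ [] ⟧
  ⨾ rY ⟦ [] ⟧≔ rZ ⟦ [] ⟧
  ⨾ rZ ⟦ [] ⟧≔ rT ⟦ [] ⟧
  ⨾ link

has-resp : ∀ {s s′ u z x} → s ≈ s′ → Has s u z x → Has s′ u z x
has-resp eq (k , k< , ez , ex) =
  k , subst (k <_) (sym (eq _ _ refl)) k< , trans (eq _ _ refl) ez , trans (eq _ _ refl) ex

holds-resp : ∀ {s s′} → s ≈ s′ → ∀ it → Holds s it → Holds s′ it
holds-resp eq (axiom x)    d        = d ∘ trans (sym (eq _ _ refl))
holds-resp eq (rule y z x) (h , h′) = has-resp eq h , has-resp eq h′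

-- Sound and complete generation of rules

module Generation (f g : ℕ → List ℕ → ℕ) (B : ℕ) {Node : Set} (digits : Node → List ℕ)
                  (digits-injective : ∀ {x y} → digits x ≡ digits y → x ≡ y)
                  (length-digits : ∀ x → length (digits x) ≡ 5)
                  (Bad : Node → Set₁) where

  code : Node → ℕ
  code x = value B (digits x)

  Fits : Node → Set
  Fits x = All (_< B) (digits x)

  -- Propagation knows only numbers. Quantifying over the fitting preimages of a number avoids a
  -- decoding function; `code` is injective on nodes that fit, so at most one preimage is meant.
  BadCode : ℕ → Set₁
  BadCode u = ∀ x → Fits x → code x ≡ u → Bad x

  badCode : ∀ {x} → Fits x → Bad x → BadCode (code x)
  badCode {x} fx bad y fy eq = subst Bad
    (sym (digits-injective (value-injective (trans (length-digits y) (sym (length-digits x))) fy fx eq))) bad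

  open Propagation BadCode public

  record Inv (s : Store) : Set₁ where
    field
      lefts   : ∀ k is → s ((left , k) , is) ≡ f k is
      rights  : ∀ k is → s ((right , k) , is) ≡ g k is
      table   : Table B 5 s
      head0   : head s ≡ 0
      waiting : Queue (λ _ → ⊥) 0 s
      adj     : Adjacency s

  inv-resp : ∀ {s s′} → s ≈ s′ → Inv s → Inv s′
  inv-resp eq inv = record
    { lefts   = λ k is → trans (eq _ _ refl) (lefts k is)
    ; rights  = λ k is → trans (eq _ _ refl) (rights k is)
    ; table   = λ d i d< i≤ → trans (eq _ _ refl) (table d i d< i≤)
    ; head0   = trans (eq _ _ refl) head0
    ; waiting = queue-resp (λ _ → eq _ _ refl) (λ _ → eq _ _ refl) (eq _ _ refl) waiting
    ; adj     = adjacency-resp eq adj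
    }
    where open Inv inv

  -- Soundness sits in `Inv`, whose queue and entries respect `BadCode`; completeness sits in `ρ`,
  -- the items that the program promises to have stored. The middle component lets promises
  -- accumulate.
  Post : Store → (Item → Set) → Store → Set₁
  Post s ρ s′ = Inv s′ × (∀ it → Holds s it → Holds s′ it) × (∀ it → ρ it → Holds s′ it)

  Builds : Program → Store → ℕ → (Item → Set) → Set₁
  Builds p s C ρ = Run p s C (Post s ρ)

  Denotes : Store → List Expr → Node → Set
  Denotes s es x = evals s es ≡ digits x × Fits x

  eval-code : ∀ {s es x} → Inv s → Denotes s es x → eval s (node es) ≡ code x
  eval-code {s} {es} {x} inv (eq , fits) = trans
    (eval-node es (Inv.table inv)
      (≤-reflexive (trans (sym (length-evals s es)) (trans (cong length eq) (length-digits x))))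
      (subst (All (_< B)) (sym eq) fits))
    (cong (value B) eq)

  builds-mark : ∀ {s es x} → Inv s → Denotes s es x → Bad x →
                Builds (mark es) s (1 + cost (node es) + 16) (_≡ axiom (code x))
  builds-mark {s} {es} {x} inv den bad = run-set (run-weaken ≤-refl
    (λ { {s′} fr (q , dx , mono , _) →
        record
          { lefts = λ k is → trans (fr _ _ refl) (lefts k is)
          ; rights = λ k is → trans (fr _ _ refl) (rights k is)
          ; table = λ d i d< i≤ → trans (fr _ _ refl) (table d i d< i≤)
          ; head0 = trans (fr _ _ refl) head0
          ; waiting = q
          ; adj = record
            { adj-bad = λ u k k< bu bz → subst BadCode (sym (fr _ _ refl))
                (adj-bad u k (subst (k <_) (fr _ _ refl) k<) bu (subst BadCode (fr _ _ refl) bz))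
            ; total = total-resp (λ _ → fr _ _ refl) (fr _ _ refl) total
            }
          }
      , holds mono fr
      , λ { _ refl → subst (Dead s′) x≡ dx } })
    (run-fire (subst BadCode (sym x≡) (badCode {x} (proj₂ den) bad)) (Inv.waiting inv′)))
    where
    x≡ = eval-code {es = es} inv den
    s₁ = s [ rX , [] ↦ eval s (node es) ]
    inv′ : Inv s₁
    inv′ = inv-resp (scratch-update s refl) inv
    open Inv inv′
    open Adjacency adj
    holds : ∀ {s′} → (∀ u → Dead s₁ u → Dead s′ u) → Frame fire s₁ s′ → ∀ it → Holds s it → Holds s′ it
    holds mono fr (axiom u)    d = mono u d
    holds {s′} mono fr (rule y z x) (h , h′) = has h , has h′
      where
      has : ∀ {u z x} → Has s u z x → Has s′ u z x
      has (k , k< , ez , ex) =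
        k , subst (k <_) (sym (fr _ _ refl)) k< , trans (fr _ _ refl) ez , trans (fr _ _ refl) ex

  builds-link : ∀ {s} → Inv s → (BadCode (s (rY , [])) → BadCode (s (rZ , [])) → BadCode (s (rX , []))) →
                Run link s 40 λ s′ → Frame link s s′ × Inv s′ × (∀ it → Holds s it → Holds s′ it) ×
                  Has s′ (s (rY , [])) (s (rZ , [])) (s (rX , [])) × (∀ u z x → Has s u z x → Has s′ u z x)
  builds-link {s} inv bad = run-weaken ≤-refl
    (λ { fr (a , new , mono) → fr
      , record
          { lefts = λ k is → trans (fr _ _ refl) (lefts k is)
          ; rights = λ k is → trans (fr _ _ refl) (rights k is)
          ; table = λ d i d< i≤ → trans (fr _ _ refl) (table d i d< i≤)
          ; head0 = trans (fr _ _ refl) head0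
          ; waiting = queue-resp (λ _ → fr _ _ refl) (λ _ → fr _ _ refl) (fr _ _ refl) waiting
          ; adj = a
          }
      , (λ { (axiom u) d → d ∘ trans (sym (fr _ _ refl))
           ; (rule y z x) (h , h′) → mono _ _ _ h , mono _ _ _ h′ })
      , new , mono })
    (run-link bad adj)
    where open Inv inv

  -- `ys` is evaluated before any register changes, so only `zs` and `xs` have to be stable.
  -- Exchanging `rY` and `rZ` through `rT` makes the second `link` store the mirror copy.
  builds-imply : ∀ {s ys zs xs y z x} → Inv s →
                 Denotes s ys y → Denotes s zs z → Denotes s xs x → stables zs ≡ true → stables xs ≡ true →
                 (Bad y → Bad z → Bad x) →
                 Builds (imply ys zs xs) s
                   (1 + cost (node ys) + (1 + cost (node zs) + (1 + cost (node xs) + (40 + (2 + (2 + (2 + 40)))))))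
                   (_≡ rule (code y) (code z) (code x))
  builds-imply {s} {ys} {zs} {xs} {y} {z} {x} inv dy dz dx sz sx bad =
    run-set (run-set (run-set (run-weaken ≤-refl (λ _ q → q)
      (run-seq (builds-link inv₃ bad₁) λ {s₄} fr (_ , inv₄ , mono₄ , has₄ , _) →
        swapped s₄ fr inv₄ mono₄ has₄))))
    where
    y≡ = eval-code {es = ys} inv dy
    s₁ = s [ rY , [] ↦ eval s (node ys) ]
    inv₁ : Inv s₁
    inv₁ = inv-resp (scratch-update s refl) inv
    s₂ = s₁ [ rZ , [] ↦ eval s₁ (node zs) ]
    inv₂ : Inv s₂
    inv₂ = inv-resp (scratch-update s₁ refl) inv₁
    s₃ = s₂ [ rX , [] ↦ eval s₂ (node xs) ]
    inv₃ : Inv s₃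
    inv₃ = inv-resp (scratch-update s₂ refl) inv₂
    z≡ : eval s₁ (node zs) ≡ code z
    z≡ = eval-code {es = zs} inv₁ (trans (evals-stable (λ x is → update-≢ s x is refl) zs sz) (proj₁ dz) , proj₂ dz)
    x≡ : eval s₂ (node xs) ≡ code x
    x≡ = eval-code {es = xs} inv₂
      (trans (evals-stable (λ x is → update-≢ s₁ x is refl) xs sx)
        (trans (evals-stable (λ x is → update-≢ s x is refl) xs sx) (proj₁ dx)) , proj₂ dx)
    bad₁ : BadCode (s₃ (rY , [])) → BadCode (s₃ (rZ , [])) → BadCode (s₃ (rX , []))
    bad₁ by bz = subst BadCode (sym x≡) (badCode {x} (proj₂ dx)
      (bad (by y (proj₂ dy) (sym y≡)) (bz z (proj₂ dz) (sym z≡))))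
    swapped : ∀ s₄ → Frame link s₃ s₄ → Inv s₄ → (∀ it → Holds s₃ it → Holds s₄ it) →
              Has s₄ (s₃ (rY , [])) (s₃ (rZ , [])) (s₃ (rX , [])) →
              Run (rT ⟦ [] ⟧≔ rY ⟦ [] ⟧ ⨾ rY ⟦ [] ⟧≔ rZ ⟦ [] ⟧ ⨾ rZ ⟦ [] ⟧≔ rT ⟦ [] ⟧ ⨾ link) s₄ 46
                (Post s (_≡ rule (code y) (code z) (code x)))
    swapped s₄ fr inv₄ mono₄ has₄ = run-set (run-set (run-set (run-weaken ≤-refl
      (λ { {s₈} _ (_ , inv₈ , mono₈ , has₈ , mono′) → inv₈
         , (λ it → mono₈ it ∘ holds-resp ≈₇ it ∘ mono₄ it ∘ holds-resp ≈₃ it)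
         , λ { _ refl → subst₃ (Has s₈) y≡ z≡ x≡ (mono′ _ _ _ (has-resp ≈₇ has₄))
                      , subst₃ (Has s₈) (trans (fr _ _ refl) z≡) (trans (fr _ _ refl) y≡) (trans (fr _ _ refl) x≡) has₈ } })
      (builds-link inv₇ bad₂))))
      where
      subst₃ : (P : ℕ → ℕ → ℕ → Set) → ∀ {a b c a′ b′ c′} → a ≡ a′ → b ≡ b′ → c ≡ c′ → P a b c → P a′ b′ c′
      subst₃ P refl refl refl p = p
      s₅ = s₄ [ rT , [] ↦ s₄ (rY , []) ]
      s₆ = s₅ [ rY , [] ↦ s₅ (rZ , []) ]
      s₇ = s₆ [ rZ , [] ↦ s₆ (rT , []) ]
      ≈₃ : s ≈ s₃
      ≈₃ x is sc = trans (scratch-update s₂ refl x is sc) (trans (scratch-update s₁ refl x is sc) (scratch-update s refl x is sc))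
      ≈₇ : s₄ ≈ s₇
      ≈₇ x is sc = trans (scratch-update s₆ refl x is sc) (trans (scratch-update s₅ refl x is sc) (scratch-update s₄ refl x is sc))
      inv₇ : Inv s₇
      inv₇ = inv-resp ≈₇ inv₄
      bad₂ : BadCode (s₇ (rY , [])) → BadCode (s₇ (rZ , [])) → BadCode (s₇ (rX , []))
      bad₂ bz by = subst BadCode (sym (fr _ _ refl))
        (bad₁ (subst BadCode (fr _ _ refl) by) (subst BadCode (fr _ _ refl) bz))

  builds-skip : ∀ {s} → Inv s → Builds skip s 1 λ _ → ⊥
  builds-skip inv = run-skip (inv , (λ _ → id) , λ _ ())

  builds-seq-with : ∀ {p q s B₁ B₂ ρ₁ ρ₂} {J : Store → Set} → Run p s B₁ (λ s′ → Post s ρ₁ s′ × J s′) →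
                    (∀ {s′} → Frame p s s′ → Inv s′ → J s′ → Builds q s′ B₂ ρ₂) →
                    Builds (p ⨾ q) s (B₁ + B₂) (ρ₁ ∪ ρ₂)
  builds-seq-with b c = run-seq b λ fr ((inv , mono₁ , has₁) , j) → run-weaken ≤-refl
    (λ _ (inv′ , mono₂ , has₂) → inv′ , (λ it → mono₂ it ∘ mono₁ it)
      , λ { it (inj₁ r) → mono₂ it (has₁ it r) ; it (inj₂ r) → has₂ it r })
    (c fr inv j)

  builds-seq : ∀ {p q s B₁ B₂ ρ₁ ρ₂} → Builds p s B₁ ρ₁ →
               (∀ {s′} → Frame p s s′ → Inv s′ → Builds q s′ B₂ ρ₂) → Builds (p ⨾ q) s (B₁ + B₂) (ρ₁ ∪ ρ₂)
  builds-seq b c = builds-seq-with {J = λ _ → ⊤} (run-weaken ≤-refl (λ _ q → q , tt) b) λ fr inv _ → c fr inv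

  builds-cond : ∀ {e p q s B₁ B₂ ρ₁ ρ₂} b → eval s e ≡ bit b →
                (b ≡ true → Builds p s B₁ ρ₁) → (b ≡ false → Builds q s B₂ ρ₂) →
                Builds (cond e p q) s (1 + (cost e + (B₁ ⊔ B₂))) (λ it → if b then ρ₁ it else ρ₂ it)
  builds-cond {e} true  eq f g = run-cond e (λ _ → f refl) (λ e≡0 → case trans (sym eq) e≡0 of λ ())
  builds-cond {e} false eq f g = run-cond e (λ e≢0 → contradiction eq e≢0) (λ _ → g refl)

  -- J is an invariant about variables other than those of Inv.
  builds-for-with : ∀ {s C n} i x p (J : ℕ → Store → Set) {ρ : Fin n → Item → Set} →
    assigns p i ≡ false → assigns (for i x p) x ≡ false → scratch i ≡ true → s (x , []) ≡ n → 1 ≤ n →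
    (∀ {k s′ v} → J k s′ → J k (s′ [ i , [] ↦ v ])) →
    (∀ (k : Fin n) {s′} → Frame (for i x p) s s′ → s′ (i , []) ≡ toℕ k → Inv s′ → J (toℕ k) s′ →
      Run p s′ C λ s″ → Post s′ (ρ k) s″ × J (suc (toℕ k)) s″) →
    Inv s → J 0 s →
    Run (for i x p) s (n * (C + 14)) λ s′ → Post s (λ it → ∃[ k ] ρ k it) s′ × J n s′
  builds-for-with {s} {n = n} i x p J {ρ} ai ax sc ex 1≤n upd step inv j = run-weaken ≤-refl
    (λ _ (inv′ , mono , has , j′) → (inv′ , mono , λ { it (k , r) → has k (toℕ<n k) it r }) , j′)
    (run-for i x p I ai ax ex 1≤n
      (λ { {s′ = s′} (inv′ , mono , has , j′) →
           inv-resp (scratch-update s′ sc) inv′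
         , (λ it → holds-resp (scratch-update s′ sc) it ∘ mono it)
         , (λ k k< it → holds-resp (scratch-update s′ sc) it ∘ has k k< it)
         , upd j′ })
      (λ { k fr ek (inv′ , mono , has , j′) → run-weaken ≤-refl
           (λ { _ ((inv″ , mono′ , has′) , j″) → inv″ , (λ it → mono′ it ∘ mono it)
              , extend has mono′ has′ , j″ })
           (step k fr ek inv′ j′) })
      (inv , (λ _ → id) , (λ _ ()) , j))
    where
    I : ℕ → Store → Set₁
    I k s′ = Inv s′ × (∀ it → Holds s it → Holds s′ it) ×
             (∀ (l : Fin n) → toℕ l < k → ∀ it → ρ l it → Holds s′ it) × J k s′
    extend : ∀ {s′ s″} {k : Fin n} → (∀ (l : Fin n) → toℕ l < toℕ k → ∀ it → ρ l it → Holds s′ it) →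
             (∀ it → Holds s′ it → Holds s″ it) → (∀ it → ρ k it → Holds s″ it) →
             ∀ (l : Fin n) → toℕ l < suc (toℕ k) → ∀ it → ρ l it → Holds s″ it
    extend {k = k} has mono′ has′ l l< it r with toℕ l ≟ toℕ k
    ... | yes l≡k = has′ it (subst (λ l → ρ l it) (toℕ-injective l≡k) r)
    ... | no l≢k  = mono′ it (has l (≤∧≢⇒< (s≤s⁻¹ l<) l≢k) it r)

  builds-for : ∀ {s C n} i x p {ρ : Fin n → Item → Set} →
    assigns p i ≡ false → assigns (for i x p) x ≡ false → scratch i ≡ true → s (x , []) ≡ n → 1 ≤ n →
    (∀ (k : Fin n) {s′} → Frame (for i x p) s s′ → s′ (i , []) ≡ toℕ k → Inv s′ → Builds p s′ C (ρ k)) →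
    Inv s → Builds (for i x p) s (n * (C + 14)) λ it → ∃[ k ] ρ k it
  builds-for i x p ai ax sc ex 1≤n step inv = run-weaken ≤-refl (λ _ → proj₁)
    (builds-for-with i x p (λ _ _ → ⊤) ai ax sc ex 1≤n (λ _ → tt)
      (λ k fr ek inv′ _ → run-weaken ≤-refl (λ _ q → q , tt) (step k fr ek inv′)) inv tt)

  Closed : (ℕ → Set) → Item → Set
  Closed D (axiom x)    = D x
  Closed D (rule y z x) = D y → D z → D x

  -- Tables, rules, propagation and output combined

  module Pipeline {m n : ℕ} (#f : f 1 [] ≡ m) (#g : g 1 [] ≡ n) (1≤m : 1 ≤ m) (1≤n : 1 ≤ n) (m≤B : m ≤ B) (n≤B : n ≤ B)
                  (S : Fin m → Fin n → Node) (digits-S : ∀ i j → digits (S i j) ≡ 0 ∷ toℕ i ∷ toℕ j ∷ 0 ∷ 0 ∷ []) where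

    1≤B : 1 ≤ B
    1≤B = ≤-trans 1≤m m≤B

    fits-S : ∀ i j → Fits (S i j)
    fits-S i j = subst (All (_< B)) (sym (digits-S i j))
      (1≤B ∷ <-≤-trans (toℕ<n i) m≤B ∷ <-≤-trans (toℕ<n j) n≤B ∷ 1≤B ∷ 1≤B ∷ [])

    Written : Store → Store → ℕ → ℕ → Set
    Written s s′ i j = s′ (output , i ∷ j ∷ []) ≡ 1 ∸ s (dead# , value B (0 ∷ i ∷ j ∷ 0 ∷ 0 ∷ []) ∷ [])

    run-report : ∀ {s} → Table B 5 s → s ((left , 1) , []) ≡ m → s ((right , 1) , []) ≡ n →
                 Run report s (m * (n * (60 + 14) + 14)) λ s′ → ∀ (i : Fin m) (j : Fin n) → Written s s′ (toℕ i) (toℕ j)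
    run-report {s} tbl em en = run-weaken ≤-refl (λ _ w i j → w i (toℕ<n i) j)
      (run-for loop-i (left , 1) (for loop-j (right , 1) write)
        (λ k s′ → ∀ (i : Fin m) → toℕ i < k → ∀ (j : Fin n) → Written s s′ (toℕ i) (toℕ j)) refl refl em 1≤m id
        (λ i {s₁} fr₁ ei w → run-weaken ≤-refl
          (λ { {s′} _ (w₁ , w₂) → λ i′ i′< j → case toℕ i′ ≟ toℕ i of λ
             { (yes i≡) → subst (λ l → Written s s′ l (toℕ j)) (sym i≡) (w₂ j (toℕ<n j))
             ; (no i≢) → w₁ i′ (≤∧≢⇒< (s≤s⁻¹ i′<) i≢) j } })
          (run-for loop-j (right , 1) write (I (toℕ i)) refl refl (trans (fr₁ _ _ refl) en) 1≤n id
            (λ j {s₂} fr₂ ej (w₁ , w₂) → run-≤ (≤ᵇ⇒≤ _ 60 _) (run-assign (step i j s₂ (trans (fr₂ _ _ refl) ei) ej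
              (λ d i d< i≤ → trans (fr₂ _ _ refl) (trans (fr₁ _ _ refl) (tbl d i d< i≤)))
              (λ u → trans (fr₂ _ _ refl) (fr₁ _ _ refl)) w₁ w₂)))
            (w , λ _ ())))
        λ _ ())
      where
      I : ℕ → ℕ → Store → Set
      I k l s′ = (∀ (i : Fin m) → toℕ i < k → ∀ (j : Fin n) → Written s s′ (toℕ i) (toℕ j)) ×
                 (∀ (j : Fin n) → toℕ j < l → Written s s′ k (toℕ j))
      step : ∀ (i : Fin m) (j : Fin n) s₂ → s₂ (loop-i , []) ≡ toℕ i → s₂ (loop-j , []) ≡ toℕ j →
             Table B 5 s₂ → (∀ u → dead s₂ u ≡ dead s u) →
             (∀ (i′ : Fin m) → toℕ i′ < toℕ i → ∀ (j : Fin n) → Written s s₂ (toℕ i′) (toℕ j)) →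
             (∀ (j′ : Fin n) → toℕ j′ < toℕ j → Written s s₂ (toℕ i) (toℕ j′)) →
             I (toℕ i) (suc (toℕ j)) (s₂ [ output , s₂ (loop-i , []) ∷ s₂ (loop-j , []) ∷ []
                                         ↦ 1 ∸ dead s₂ (eval s₂ (node coords)) ])
      step i j s₂ ei ej tbl₂ dead-≡ w₁ w₂ =
        (λ i′ i′< j′ → trans (other λ eq → <⇒≢ i′< (trans (index eq) ei)) (w₁ i′ i′< j′)) ,
        λ j′ j′<1+j → case toℕ j′ ≟ toℕ j of λ
          { (yes j′≡j) → subst (Written s s₃ (toℕ i)) (sym j′≡j) here
          ; (no j′≢j) → trans (other λ eq → j′≢j (trans (index₂ eq) ej)) (w₂ j′ (≤∧≢⇒< (s≤s⁻¹ j′<1+j) j′≢j)) }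
        where
        index : ∀ {a b a′ b′ : ℕ} → _≡_ {A = Cell} (output , a ∷ b ∷ []) (output , a′ ∷ b′ ∷ []) → a ≡ a′
        index refl = refl
        index₂ : ∀ {a b a′ b′ : ℕ} → _≡_ {A = Cell} (output , a ∷ b ∷ []) (output , a′ ∷ b′ ∷ []) → b ≡ b′
        index₂ refl = refl
        cell = output , s₂ (loop-i , []) ∷ s₂ (loop-j , []) ∷ []
        s₃ = s₂ [ cell ↦ 1 ∸ dead s₂ (eval s₂ (node coords)) ]
        other : ∀ {a b} → (output , a ∷ b ∷ []) ≢ cell → s₃ (output , a ∷ b ∷ []) ≡ s₂ (output , a ∷ b ∷ [])
        other = update-other s₂ cell
        coords-≡ : evals s₂ coords ≡ 0 ∷ toℕ i ∷ toℕ j ∷ 0 ∷ 0 ∷ []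
        coords-≡ = cong₂ (λ a b → 0 ∷ a ∷ b ∷ 0 ∷ 0 ∷ []) ei ej
        code-≡ : eval s₂ (node coords) ≡ value B (0 ∷ toℕ i ∷ toℕ j ∷ 0 ∷ 0 ∷ [])
        code-≡ = trans (eval-node {s = s₂} coords tbl₂ ≤-refl
          (subst (All (_< B)) (trans (digits-S i j) (sym coords-≡)) (fits-S i j))) (cong (value B) coords-≡)
        here : Written s s₃ (toℕ i) (toℕ j)
        here = trans (cong s₃ (cong₂ (λ a b → output , a ∷ b ∷ []) (sym ei) (sym ej)))
          (trans (update-same s₂ cell) (cong (1 ∸_) (trans (cong (dead s₂) code-≡) (dead-≡ _))))

    -- `b` and `c` measure the base and the generating time in units of `Z`. The factor 200 is five
    -- table rows of `B * 40` operations. Solving costs 84 for each unit of `2 * size + qlen`, which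
    -- is at most `3 * C`; with generation itself this makes 253. The summand 94 covers the output
    -- and the constant overhead. The set of dead nodes is exported as an abstract decidable `D`, so
    -- what follows no longer mentions the final store of the solver.
    result : ∀ p e {C ρ Z} b c → eval (input f g) e ≡ B → counts size# p ≡ true → counts qlen# p ≡ true →
             (∀ {s} → Frame (init e) (input f g) s → Inv s → Builds p s C ρ) →
             B ≤ b * Z → C ≤ c * Z → m * n ≤ Z →
             Run (init e ⨾ p ⨾ solve ⨾ report) (input f g) ((cost e + b * 200 + c * 253 + 94) * Z) λ s →
               ∃[ D ] (∀ u → Dec (D u)) × (∀ it → ρ it → Closed D it) ×
                 (∀ x → Fits x → D (code x) → Bad x) ×
                 (∀ i j → outputRel s i j → ¬ D (code (S i j))) × (∀ i j → ¬ D (code (S i j)) → outputRel s i j)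
    result p e {C} {ρ} {Z} b c refl sz ql build B≤ C≤ mn≤ = run-≤ bound
      (run-seq (run-init {f} {g} e 1≤B) λ fr₀ tbl →
       let inv₀ : Inv _
           inv₀ = record
             { lefts = λ _ _ → fr₀ _ _ refl
             ; rights = λ _ _ → fr₀ _ _ refl
             ; table = tbl
             ; head0 = fr₀ _ _ refl
             ; waiting = record
               { h≤qlen = z≤n
               ; dead-bad = λ u d → contradiction (fr₀ _ _ refl) d
               ; dead-queued = λ u d → contradiction (fr₀ _ _ refl) d
               ; queued-dead = λ i i< → contradiction i< (<⇒≱ (s≤s (≤-trans (≤-reflexive (fr₀ _ _ refl)) z≤n)))
               }
             ; adj = record
               { adj-bad = λ u k k< → contradiction k< (<⇒≱ (s≤s (≤-trans (≤-reflexive (fr₀ _ _ refl)) z≤n)))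
               ; total = 0 , (λ _ _ → fr₀ _ _ refl) , sym (fr₀ _ _ refl)
               }
             }
       -- Both counters start at 0 and are only ever incremented, so after generation each is at
       -- most `C`.
       in run-seq (run-count size# sz (run-count qlen# ql (build fr₀ inv₀))) λ {s₁} fr₁ (size≤ , qlen≤ , inv₁ , _ , has) →
       run-seq (run-≤ (solve-bound s₁ (≤-trans size≤ (+-monoˡ-≤ C (≤-reflexive (fr₀ _ _ refl))))
                                      (≤-trans qlen≤ (+-monoˡ-≤ C (≤-reflexive (fr₀ _ _ refl)))))
                 (Solving.run-solve BadCode s₁ (Inv.adj inv₁) (Inv.head0 inv₁) (Inv.waiting inv₁)))
         λ {s₂} fr₂ (sound , mono , closed) →
       run-weaken ≤-refl
         (λ {s₃} _ w → Dead s₂ , (λ u → ¬? (dead s₂ u ≟ 0))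
           , (λ { (axiom x) r → mono x (has _ r)
                ; (rule y z x) r dy dz → closed y z x (has _ r) dy dz })
           , (λ x fx d → sound (code x) d x fx refl)
           , (λ i j out d → d (1∸≡1 (trans (sym (w′ s₂ s₃ w i j)) out)))
           , (λ i j ¬d → trans (w′ s₂ s₃ w i j) (cong (1 ∸_) (decidable-stable (dead s₂ (code (S i j)) ≟ 0) ¬d))))
         (run-report (λ d i d< i≤ → trans (fr₂ _ _ refl) (Inv.table inv₁ d i d< i≤))
           (trans (fr₂ _ _ refl) (trans (Inv.lefts inv₁ 1 []) #f)) (trans (fr₂ _ _ refl) (trans (Inv.rights inv₁ 1 []) #g))))
      where
      1∸≡1 : ∀ {k} → 1 ∸ k ≡ 1 → k ≡ 0
      1∸≡1 {zero}        _  = refl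
      1∸≡1 {suc zero}    ()
      1∸≡1 {suc (suc _)} ()
      w′ : ∀ s₂ s₃ → (∀ i j → Written s₂ s₃ (toℕ i) (toℕ j)) → ∀ (i : Fin m) (j : Fin n) →
           s₃ (output , toℕ i ∷ toℕ j ∷ []) ≡ 1 ∸ dead s₂ (code (S i j))
      w′ s₂ s₃ w i j = trans (w i j) (cong (λ ds → 1 ∸ dead s₂ (value B ds)) (sym (digits-S i j)))
      solve-bound : ∀ s → s (size# , []) ≤ C → qlen s ≤ C → (2 * s (size# , []) + qlen s) * 84 + 4 ≤ C * 252 + 4
      solve-bound s size≤ qlen≤ = +-monoˡ-≤ 4 (begin
        (2 * s (size# , []) + qlen s) * 84  ≤⟨ *-monoˡ-≤ 84 (+-mono-≤ (*-monoʳ-≤ 2 size≤) qlen≤) ⟩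
        (2 * C + C) * 84                    ≡⟨ lemma C ⟩
        C * 252                             ∎)
        where
        open ≤-Reasoning
        lemma : ∀ k → (2 * k + k) * 84 ≡ k * 252
        lemma = solve-∀
      bound : 1 + cost e + (1 + 5 * (B * 40)) + (C + (C * 252 + 4 + m * (n * (60 + 14) + 14))) ≤
              (cost e + b * 200 + c * 253 + 94) * Z
      bound = begin
        1 + cost e + (1 + 5 * (B * 40)) + (C + (C * 252 + 4 + m * (n * 74 + 14)))
          ≤⟨ +-monoʳ-≤ (1 + cost e + (1 + 5 * (B * 40))) (+-monoʳ-≤ C (+-monoʳ-≤ (C * 252 + 4)
               (*-monoʳ-≤ m (+-monoʳ-≤ (n * 74) (*-monoˡ-≤ 14 1≤n))))) ⟩
        1 + cost e + (1 + 5 * (B * 40)) + (C + (C * 252 + 4 + m * (n * 74 + n * 14)))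
          ≡⟨ lemma₁ (cost e) B C m n ⟩
        (cost e + 6) * 1 + B * 200 + C * 253 + m * n * 88
          ≤⟨ +-mono-≤ (+-mono-≤ (+-mono-≤ (*-monoʳ-≤ (cost e + 6) 1≤Z) (*-monoˡ-≤ 200 B≤)) (*-monoˡ-≤ 253 C≤)) (*-monoˡ-≤ 88 mn≤) ⟩
        (cost e + 6) * Z + b * Z * 200 + c * Z * 253 + Z * 88
          ≡⟨ lemma₂ (cost e) b c Z ⟩
        (cost e + b * 200 + c * 253 + 94) * Z  ∎
        where
        open ≤-Reasoning
        1≤Z : 1 ≤ Z
        1≤Z = ≤-trans (*-mono-≤ 1≤m 1≤n) mn≤
        lemma₁ : ∀ x b c m n → 1 + x + (1 + 5 * (b * 40)) + (c + (c * 252 + 4 + m * (n * 74 + n * 14))) ≡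
                 (x + 6) * 1 + b * 200 + c * 253 + m * n * 88
        lemma₁ = solve-∀
        lemma₂ : ∀ x b c z → (x + 6) * z + b * z * 200 + c * z * 253 + z * 88 ≡ (x + b * 200 + c * 253 + 94) * z
        lemma₂ = solve-∀

-- Alternating transition systems

at-toℕ : ∀ {n} (f : Fin n → ℕ) i → at f (toℕ i) ≡ f i
at-toℕ f zero    = refl
at-toℕ f (suc i) = at-toℕ (λ j → f (suc j)) i

at₁ : ∀ {n x} (f : Fin n → ℕ) {i} → x ≡ toℕ i → at f x ≡ f i
at₁ f {i} refl = at-toℕ f i

at₂ : ∀ {m n x y} (f : Fin m → Fin n → ℕ) {i j} → x ≡ toℕ i → y ≡ toℕ j → at (λ i → at (f i) y) x ≡ f i j
at₂ {y = y} f {i} ex ey = trans (at₁ (λ i → at (f i) y) ex) (at₁ (f i) ey)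

at₃ : ∀ {m n o x y z} (f : Fin m → Fin n → Fin o → ℕ) {i j k} → x ≡ toℕ i → y ≡ toℕ j → z ≡ toℕ k →
      at (λ i → at (λ j → at (f i j) z) y) x ≡ f i j k
at₃ {y = y} {z} f {i} ex ey ez = trans (at₁ (λ i → at (λ j → at (f i j) z) y) ex) (at₂ (f i) ey ez)

-- The sum of the two truncated differences is the distance of the numbers, which is 0 exactly for
-- equal ones; this is the equality test of the machine.
≢-test : ∀ {n} (i j : Fin n) → 1 ∸ ((toℕ i ∸ toℕ j) + (toℕ j ∸ toℕ i)) ≡ bit (does (i Fin.≟ j))
≢-test i j with i Fin.≟ j
... | yes refl = cong (λ d → 1 ∸ (d + d)) (n∸n≡0 (toℕ i))
... | no i≢j with (toℕ i ∸ toℕ j) + (toℕ j ∸ toℕ i) in eq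
...   | suc d = 0∸n≡0 d
...   | zero  = contradiction (toℕ-injective (≤-antisym
  (m∸n≡0⇒m≤n (m+n≡0⇒m≡0 _ eq)) (m∸n≡0⇒m≤n (m+n≡0⇒n≡0 (toℕ i ∸ toℕ j) eq)))) i≢j

if-true : ∀ {A B : Set} {b} → b ≡ true → A → if b then A else B
if-true refl x = x

<-+1 : ∀ {n} {i j : Fin n} → toℕ i < toℕ j + 1 → toℕ i < toℕ j ⊎ i ≡ j
<-+1 {i = i} {j} i< with toℕ i ≟ toℕ j
... | yes i≡j = inj₂ (toℕ-injective i≡j)
... | no i≢j  = inj₁ (≤∧≢⇒< (s≤s⁻¹ (subst (toℕ i <_) (+-comm (toℕ j) 1) i<)) i≢j)

-- A chain of rules read backwards: death starts at 0 and is passed on except at a good index, so an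
-- alive end yields such an index.
chain : ∀ {n} (X : ℕ → Set) (Good : Fin n → Set) → X 0 →
        (∀ i → X (toℕ i) → Good i ⊎ X (toℕ i + 1)) → ¬ X n → ∃ Good
chain {n} X Good x₀ step ¬xₙ = case go n ≤-refl of λ { (inj₁ g) → g ; (inj₂ x) → contradiction x ¬xₙ }
  where
  go : ∀ k → k ≤ n → ∃ Good ⊎ X k
  go zero    _   = inj₂ x₀
  go (suc k) k<n with go k (<⇒≤ k<n)
  ... | inj₁ g = inj₁ g
  ... | inj₂ x with step (fromℕ< k<n) (subst X (sym (toℕ-fromℕ< k<n)) x)
  ...   | inj₁ g = inj₁ (_ , g)
  ...   | inj₂ y = inj₂ (subst X (trans (cong (_+ 1) (toℕ-fromℕ< k<n)) (+-comm k 1)) y)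

<+4 : ∀ {m n} → m ≤ n → m < n + 4
<+4 {m} {n} m≤n = ≤-trans (≤-trans (s≤s m≤n) (≤-reflexive (+-comm 1 n))) (+-monoʳ-≤ n (s≤s z≤n))

-- Charges the constant overhead of a loop body to the inner bound `X`, which is at least 1; nested
-- loops thus keep a bound in product form.
absorb : ∀ n {X} k c → 1 ≤ X → n * (X * k + c) ≤ n * X * (k + c)
absorb n {X} k c 1≤X = begin
  n * (X * k + c)      ≤⟨ *-monoʳ-≤ n (+-monoʳ-≤ (X * k) (≤-trans (≤-reflexive (sym (*-identityˡ c))) (*-monoˡ-≤ c 1≤X))) ⟩
  n * (X * k + X * c)  ≡⟨ cong (n *_) (sym (*-distribˡ-+ X k c)) ⟩
  n * (X * (k + c))    ≡⟨ sym (*-assoc n X (k + c)) ⟩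
  n * X * (k + c)      ∎
  where open ≤-Reasoning

≤-*ʳ : ∀ {m n} → 1 ≤ n → m ≤ m * n
≤-*ʳ {m} 1≤n = ≤-trans (≤-reflexive (sym (*-identityʳ m))) (*-monoʳ-≤ m 1≤n)

≤-*ˡ : ∀ {m n} → 1 ≤ n → m ≤ n * m
≤-*ˡ {m} {n} 1≤n = ≤-trans (≤-*ʳ 1≤n) (≤-reflexive (*-comm m n))

Fin⇒1≤ : ∀ {n} → Fin n → 1 ≤ n
Fin⇒1≤ {suc n} _ = s≤s z≤n

quadruple-≡ : ∀ {A : Set} {m n o} (F : Fin m → Fin n → Fin o → ℕ → A) {i i′ j j′ k k′ l l′} →
              _≡_ {A = List ℕ} (toℕ i ∷ toℕ j ∷ toℕ k ∷ l ∷ []) (toℕ i′ ∷ toℕ j′ ∷ toℕ k′ ∷ l′ ∷ []) →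
              F i j k l ≡ F i′ j′ k′ l′
quadruple-≡ F {i} {i′} {j} {j′} {k} {k′} eq
  with toℕ-injective {i = i} {i′} (∷-injectiveˡ eq)
     | toℕ-injective {i = j} {j′} (∷-injectiveˡ (∷-injectiveʳ eq))
     | toℕ-injective {i = k} {k′} (∷-injectiveˡ (∷-injectiveʳ (∷-injectiveʳ eq)))
     | ∷-injectiveˡ (∷-injectiveʳ (∷-injectiveʳ (∷-injectiveʳ eq)))
... | refl | refl | refl | refl = refl

pattern w#  = work , 23
pattern w′# = work , 24
pattern a#  = work , 25
pattern b#  = work , 26
pattern a′# = work , 27
pattern b′# = work , 28

var : Name → Expr
var x = x ⟦ [] ⟧

S# : Expr → Expr → List Expr
S# w w′ = lit 0 ∷ w ∷ w′ ∷ lit 0 ∷ lit 0 ∷ []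

-- The parameter is the index of the label array, which is 5 for an ATS and 4 for a TS.
labels : ℕ → Program
labels k = cond (lit 1 ⊖ ((l ⊖ l′) ⊕ (l′ ⊖ l))) skip (mark (S# (var w#) (var w′#)))
  where
  l  = (left , k) ⟦ var w# ∷ [] ⟧
  l′ = (right , k) ⟦ var w′# ∷ [] ⟧

-- The rules of an alternating transition system

module ATSProgram where

  T# : Expr → Expr → List Expr
  T# v′ b = lit 1 ∷ var w# ∷ var a# ∷ v′ ∷ b ∷ []

  V# : Expr → List Expr
  V# k = lit 2 ∷ var w# ∷ var a# ∷ var w′# ∷ k ∷ []

  base-expr : Expr
  base-expr = var (left , 1) ⊕ var (right , 1) ⊕ var (left , 2) ⊕ var (left , 3) ⊕ var (right , 2) ⊕ var (right , 3) ⊕ lit 4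

  b-body : Program
  b-body = cond ((left , 7) ⟦ var w# ∷ var b# ∷ [] ⟧)
    (imply (T# (var w′#) (var b#)) (S# ((left , 8) ⟦ var w# ∷ var a# ∷ var b# ∷ [] ⟧) (var w′#)) (T# (var w′#) (var b# ⊕ lit 1)))
    (imply (T# (var w′#) (var b#)) (T# (var w′#) (var b#)) (T# (var w′#) (var b# ⊕ lit 1)))

  -- The `T` chain referred to may not have been generated yet. Rules are merely stored at this
  -- stage, so the order of generation is immaterial.
  b′-body : Program
  b′-body = cond ((right , 7) ⟦ var w′# ∷ var b′# ∷ [] ⟧)
    (imply (V# (var a′#)) (T# ((right , 8) ⟦ var w′# ∷ var a′# ∷ var b′# ∷ [] ⟧) (var (left , 3))) (V# (var a′# ⊕ lit 1)))
    skip

  a′-body : Program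
  a′-body = cond ((right , 6) ⟦ var w′# ∷ var a′# ∷ [] ⟧)
    (for b′# (right , 3) b′-body)
    (imply (V# (var a′#)) (V# (var a′#)) (V# (var a′# ⊕ lit 1)))

  conclude : Program
  conclude = cond ((left , 6) ⟦ var w# ∷ var a# ∷ [] ⟧)
    (imply (V# (var (right , 2))) (V# (var (right , 2))) (S# (var w#) (var w′#))) skip

  -- The loop variable `w′#` plays two roles: it is the target state `v′` of the `T` chain and the
  -- state `w′` of the `V` chain. The two inner loops follow one another, so their lengths add.
  a-body : Program
  a-body = mark (T# (var w′#) (lit 0)) ⨾ mark (V# (lit 0)) ⨾
           for b# (left , 3) b-body ⨾ for a′# (right , 2) a′-body ⨾ conclude

  build : Program
  build = for w# (left , 1) (for w′# (right , 1) (labels 5 ⨾ for a# (left , 2) a-body))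

  program : Program
  program = init base-expr ⨾ build ⨾ solve ⨾ report

  -- Abstract, since the type checker would otherwise unfold c * Z into a
  -- sum of c terms.
  abstract
    constant : ℕ
    constant = cost base-expr + 10 * 200 + 1594 * 253 + 94

    constant-≡ : cost base-expr + 10 * 200 + 1594 * 253 + 94 ≡ constant
    constant-≡ = refl

-- Correctness and time for alternating transition systems

module ATSCorrect {σ : ℕ} (K K′ : ATS σ) where
  open ATSProgram
  private
    module K  = ATS K
    module K′ = ATS K′

  data Node : Set where
    S : Fin K.#W → Fin K′.#W → Node
    T : Fin K.#W → Fin K.#A₁ → Fin K′.#W → ℕ → Node
    V : Fin K.#W → Fin K.#A₁ → Fin K′.#W → ℕ → Node

  digits : Node → List ℕ
  digits (S w w′)     = 0 ∷ toℕ w ∷ toℕ w′ ∷ 0 ∷ 0 ∷ []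
  digits (T w a v′ n) = 1 ∷ toℕ w ∷ toℕ a ∷ toℕ v′ ∷ n ∷ []
  digits (V w a w′ n) = 2 ∷ toℕ w ∷ toℕ a ∷ toℕ w′ ∷ n ∷ []

  digits-injective : ∀ {x y} → digits x ≡ digits y → x ≡ y
  digits-injective {x} {y} = go x y
    where
    go : ∀ x y → digits x ≡ digits y → x ≡ y
    go (S _ _)     (S _ _)     eq with ∷-injective (∷-injectiveʳ eq)
    ... | e₁ , eq′ = cong₂ S (toℕ-injective e₁) (toℕ-injective (∷-injectiveˡ eq′))
    go (T _ _ _ _) (T _ _ _ _) eq = quadruple-≡ T (∷-injectiveʳ eq)
    go (V _ _ _ _) (V _ _ _ _) eq = quadruple-≡ V (∷-injectiveʳ eq)
    go (S _ _) (T _ _ _ _) ()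
    go (S _ _) (V _ _ _ _) ()
    go (T _ _ _ _) (S _ _) ()
    go (T _ _ _ _) (V _ _ _ _) ()
    go (V _ _ _ _) (S _ _) ()
    go (V _ _ _ _) (T _ _ _ _) ()

  length-digits : ∀ x → length (digits x) ≡ 5
  length-digits (S _ _)     = refl
  length-digits (T _ _ _ _) = refl
  length-digits (V _ _ _ _) = refl

  -- What the death of a node proves about an arbitrary alternating simulation `R`. In the case of
  -- `V` the failure of `a′` is recorded by a move `b′` that defeats it.
  Bad : Node → Set₁
  Bad (S w w′)     = ∀ R → IsAltSim K K′ R → ¬ R w w′
  Bad (T w a v′ n) = ∀ R → IsAltSim K K′ R → ∀ b → toℕ b < n → b ∈ˢ K.P₂ w → ¬ R (K.δ w a b) v′
  Bad (V w a w′ n) = ∀ R → IsAltSim K K′ R → ∀ a′ → toℕ a′ < n → a′ ∈ˢ K′.P₁ w′ →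
    ∃[ b′ ] b′ ∈ˢ K′.P₂ w′ × ∀ b → b ∈ˢ K.P₂ w → ¬ R (K.δ w a b) (K′.δ w′ a′ b′)

  B : ℕ
  B = K.#W + K′.#W + K.#A₁ + K.#A₂ + K′.#A₁ + K′.#A₂ + 4

  open Generation (encodeATS K) (encodeATS K′) B digits (λ {x} {y} → digits-injective {x} {y}) length-digits Bad

  2<B : 2 < B
  2<B = ≤-trans (n≤1+n 3) (m≤n+m 4 _)
  1<B : 1 < B
  1<B = ≤-trans (n≤1+n 2) 2<B
  0<B : 0 < B
  0<B = ≤-trans (n≤1+n 1) 1<B
  W<B : K.#W < B
  W<B = <+4 (m≤n⇒m≤n+o _ (m≤n⇒m≤n+o _ (m≤n⇒m≤n+o _ (m≤n⇒m≤n+o _ (m≤m+n _ _)))))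
  W′<B : K′.#W < B
  W′<B = <+4 (m≤n⇒m≤n+o _ (m≤n⇒m≤n+o _ (m≤n⇒m≤n+o _ (m≤n⇒m≤n+o _ (m≤n+m _ K.#W)))))
  A₁<B : K.#A₁ < B
  A₁<B = <+4 (m≤n⇒m≤n+o _ (m≤n⇒m≤n+o _ (m≤n⇒m≤n+o _ (m≤n+m _ (K.#W + K′.#W)))))
  A₂<B : K.#A₂ < B
  A₂<B = <+4 (m≤n⇒m≤n+o _ (m≤n⇒m≤n+o _ (m≤n+m _ (K.#W + K′.#W + K.#A₁))))
  A₁′<B : K′.#A₁ < B
  A₁′<B = <+4 (m≤n⇒m≤n+o _ (m≤n+m _ (K.#W + K′.#W + K.#A₁ + K.#A₂)))

  fits-S : ∀ w w′ → Fits (S w w′)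
  fits-S w w′ = 0<B ∷ <-trans (toℕ<n w) W<B ∷ <-trans (toℕ<n w′) W′<B ∷ 0<B ∷ 0<B ∷ []

  fits-T : ∀ w a v′ {n} → n ≤ K.#A₂ → Fits (T w a v′ n)
  fits-T w a v′ n≤ = 1<B ∷ <-trans (toℕ<n w) W<B ∷ <-trans (toℕ<n a) A₁<B ∷ <-trans (toℕ<n v′) W′<B ∷ ≤-<-trans n≤ A₂<B ∷ []

  fits-V : ∀ w a w′ {n} → n ≤ K′.#A₁ → Fits (V w a w′ n)
  fits-V w a w′ n≤ = 2<B ∷ <-trans (toℕ<n w) W<B ∷ <-trans (toℕ<n a) A₁<B ∷ <-trans (toℕ<n w′) W′<B ∷ ≤-<-trans n≤ A₁′<B ∷ []

  -- This and the following item sets branch on the same Booleans as the program, so `builds-cond`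
  -- produces them without conversion.
  labelled : Fin K.#W → Fin K′.#W → Item → Set
  labelled w w′ it = if does (K.L w Fin.≟ K′.L w′) then ⊥ else it ≡ axiom (code (S w w′))

  stepT : Fin K.#W → Fin K′.#W → Fin K.#A₁ → Fin K.#A₂ → Item → Set
  stepT w w′ a b it =
    if lookup (K.P₂ w) b
    then it ≡ rule (code (T w a w′ (toℕ b))) (code (S (K.δ w a b) w′)) (code (T w a w′ (toℕ b + 1)))
    else it ≡ rule (code (T w a w′ (toℕ b))) (code (T w a w′ (toℕ b))) (code (T w a w′ (toℕ b + 1)))

  replyV : Fin K.#W → Fin K′.#W → Fin K.#A₁ → Fin K′.#A₁ → Fin K′.#A₂ → Item → Set
  replyV w w′ a a′ b′ it =
    if lookup (K′.P₂ w′) b′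
    then it ≡ rule (code (V w a w′ (toℕ a′))) (code (T w a (K′.δ w′ a′ b′) K.#A₂)) (code (V w a w′ (toℕ a′ + 1)))
    else ⊥

  skipV : Fin K.#W → Fin K′.#W → Fin K.#A₁ → Fin K′.#A₁ → Item → Set
  skipV w w′ a a′ it = it ≡ rule (code (V w a w′ (toℕ a′))) (code (V w a w′ (toℕ a′))) (code (V w a w′ (toℕ a′ + 1)))

  stepV : Fin K.#W → Fin K′.#W → Fin K.#A₁ → Fin K′.#A₁ → Item → Set
  stepV w w′ a a′ it = if lookup (K′.P₁ w′) a′ then (∃[ b′ ] replyV w w′ a a′ b′ it) else skipV w w′ a a′ it

  concluded : Fin K.#W → Fin K′.#W → Fin K.#A₁ → Item → Set
  concluded w w′ a it =
    if lookup (K.P₁ w) a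
    then it ≡ rule (code (V w a w′ K′.#A₁)) (code (V w a w′ K′.#A₁)) (code (S w w′))
    else ⊥

  items-a : Fin K.#W → Fin K′.#W → Fin K.#A₁ → Item → Set
  items-a w w′ a = (_≡ axiom (code (T w a w′ 0))) ∪ ((_≡ axiom (code (V w a w′ 0))) ∪
    ((λ it → ∃[ b ] stepT w w′ a b it) ∪ ((λ it → ∃[ a′ ] stepV w w′ a a′ it) ∪ concluded w w′ a)))

  items : Item → Set
  items it = ∃[ w ] ∃[ w′ ] (labelled w w′ ∪ (λ it → ∃[ a ] items-a w w′ a it)) it

  module _ {s : Store} (inv : Inv s) {w : Fin K.#W} {w′ : Fin K′.#W}
           (ew : s (w# , []) ≡ toℕ w) (ew′ : s (w′# , []) ≡ toℕ w′) where
    open Inv inv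

    denotes-S : Denotes s (S# (var w#) (var w′#)) (S w w′)
    denotes-S = cong₂ (λ i j → 0 ∷ i ∷ j ∷ 0 ∷ 0 ∷ []) ew ew′ , fits-S w w′

    builds-labels : Builds (labels 5) s 100 (labelled w w′)
    builds-labels = run-≤ (≤ᵇ⇒≤ _ 100 _) (builds-cond _
      (trans (cong₂ (λ l l′ → 1 ∸ ((l ∸ l′) + (l′ ∸ l))) eL eL′) (≢-test (K.L w) (K′.L w′)))
      (λ _ → builds-skip inv)
      λ ≢ → builds-mark {x = S w w′} inv denotes-S λ R alt r →
        case trans (sym ≢) (dec-true (K.L w Fin.≟ K′.L w′) (proj₁ (alt w w′ r))) of λ ())
      where
      eL : s ((left , 5) , s (w# , []) ∷ []) ≡ toℕ (K.L w)
      eL = trans (lefts 5 _) (at₁ (λ w → toℕ (K.L w)) ew)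
      eL′ : s ((right , 5) , s (w′# , []) ∷ []) ≡ toℕ (K′.L w′)
      eL′ = trans (rights 5 _) (at₁ (λ w → toℕ (K′.L w)) ew′)

    module _ {a : Fin K.#A₁} (ea : s (a# , []) ≡ toℕ a) where

      denotes-T : ∀ e e′ v′ {n} → eval s e ≡ toℕ v′ → eval s e′ ≡ n → n ≤ K.#A₂ → Denotes s (T# e e′) (T w a v′ n)
      denotes-T e e′ v′ ev en n≤ = trans
        (cong₂ (λ i j → 1 ∷ i ∷ j ∷ eval s e ∷ eval s e′ ∷ []) ew ea)
        (cong₂ (λ i j → 1 ∷ toℕ w ∷ toℕ a ∷ i ∷ j ∷ []) ev en) , fits-T w a v′ n≤

      denotes-V : ∀ e {n} → eval s e ≡ n → n ≤ K′.#A₁ → Denotes s (V# e) (V w a w′ n)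
      denotes-V e en n≤ = trans
        (cong₂ (λ i j → 2 ∷ i ∷ j ∷ s (w′# , []) ∷ eval s e ∷ []) ew ea)
        (cong₂ (λ i j → 2 ∷ toℕ w ∷ toℕ a ∷ i ∷ j ∷ []) ew′ en) , fits-V w a w′ n≤

      builds-b-body : ∀ {b} → s (b# , []) ≡ toℕ b → Builds b-body s 400 (stepT w w′ a b)
      builds-b-body {b} eb = run-≤ (≤ᵇ⇒≤ _ 400 _) (builds-cond _ avail
        (λ _ → builds-imply {y = T w a w′ (toℕ b)} {S (K.δ w a b) w′} {T w a w′ (toℕ b + 1)} inv
          from (cong₂ (λ i j → 0 ∷ i ∷ j ∷ 0 ∷ 0 ∷ []) eδ ew′ , fits-S _ w′) to refl refl
          λ bad bad′ R alt β β< β∈ → case <-+1 β< of λ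
            { (inj₁ β<b) → bad R alt β β<b β∈
            ; (inj₂ refl) → bad′ R alt })
        λ b∉ → builds-imply {y = T w a w′ (toℕ b)} {T w a w′ (toℕ b)} {T w a w′ (toℕ b + 1)} inv
          from from to refl refl
          λ bad _ R alt β β< β∈ → case <-+1 β< of λ
            { (inj₁ β<b) → bad R alt β β<b β∈
            ; (inj₂ refl) → case trans (sym b∉) ([]=⇒lookup β∈) of λ () })
        where
        avail : s ((left , 7) , s (w# , []) ∷ s (b# , []) ∷ []) ≡ bit (lookup (K.P₂ w) b)
        avail = trans (lefts 7 _) (at₂ (λ w b → bit (lookup (K.P₂ w) b)) ew eb)
        eδ : s ((left , 8) , s (w# , []) ∷ s (a# , []) ∷ s (b# , []) ∷ []) ≡ toℕ (K.δ w a b)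
        eδ = trans (lefts 8 _) (at₃ (λ w a b → toℕ (K.δ w a b)) ew ea eb)
        from : Denotes s (T# (var w′#) (var b#)) (T w a w′ (toℕ b))
        from = denotes-T (var w′#) (var b#) w′ ew′ eb (<⇒≤ (toℕ<n b))
        to : Denotes s (T# (var w′#) (var b# ⊕ lit 1)) (T w a w′ (toℕ b + 1))
        to = denotes-T (var w′#) (var b# ⊕ lit 1) w′ ew′ (cong (_+ 1) eb) (subst (_≤ K.#A₂) (+-comm 1 (toℕ b)) (toℕ<n b))

      module _ {a′ : Fin K′.#A₁} (ea′ : s (a′# , []) ≡ toℕ a′) where

        from-V : Denotes s (V# (var a′#)) (V w a w′ (toℕ a′))
        from-V = denotes-V (var a′#) ea′ (<⇒≤ (toℕ<n a′))

        to-V : Denotes s (V# (var a′# ⊕ lit 1)) (V w a w′ (toℕ a′ + 1))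
        to-V = denotes-V (var a′# ⊕ lit 1) (cong (_+ 1) ea′) (subst (_≤ K′.#A₁) (+-comm 1 (toℕ a′)) (toℕ<n a′))

        builds-b′-body : a′ ∈ˢ K′.P₁ w′ → ∀ {b′} → s (b′# , []) ≡ toℕ b′ → Builds b′-body s 400 (replyV w w′ a a′ b′)
        builds-b′-body a′∈ {b′} eb′ = run-≤ (≤ᵇ⇒≤ _ 400 _) (builds-cond _
          (trans (rights 7 _) (at₂ (λ w b → bit (lookup (K′.P₂ w) b)) ew′ eb′))
          (λ b′∈ → builds-imply {y = V w a w′ (toℕ a′)} {T w a (K′.δ w′ a′ b′) K.#A₂} {V w a w′ (toℕ a′ + 1)} inv
            from-V
            (denotes-T ((right , 8) ⟦ var w′# ∷ var a′# ∷ var b′# ∷ [] ⟧) (var (left , 3)) (K′.δ w′ a′ b′)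
              (trans (rights 8 _) (at₃ (λ w a b → toℕ (K′.δ w a b)) ew′ ea′ eb′)) (lefts 3 _) ≤-refl)
            to-V refl refl
            λ bad bad′ R alt α α< α∈ → case <-+1 α< of λ
              { (inj₁ α<a′) → bad R alt α α<a′ α∈
              ; (inj₂ refl) → b′ , lookup⇒[]= b′ _ b′∈ , λ b b∈ → bad′ R alt b (toℕ<n b) b∈ })
          λ _ → builds-skip inv)

        builds-a′-skip : lookup (K′.P₁ w′) a′ ≡ false →
          Builds (imply (V# (var a′#)) (V# (var a′#)) (V# (var a′# ⊕ lit 1))) s 360
            (skipV w w′ a a′)
        builds-a′-skip a′∉ = run-≤ (≤ᵇ⇒≤ _ 360 _)
          (builds-imply {y = V w a w′ (toℕ a′)} {V w a w′ (toℕ a′)} {V w a w′ (toℕ a′ + 1)} inv from-V from-V to-V refl refl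
            λ bad _ R alt α α< α∈ → case <-+1 α< of λ
              { (inj₁ α<a′) → bad R alt α α<a′ α∈
              ; (inj₂ refl) → case trans (sym a′∉) ([]=⇒lookup α∈) of λ () })

      builds-conclude : Builds conclude s 400 (concluded w w′ a)
      builds-conclude = run-≤ (≤ᵇ⇒≤ _ 400 _) (builds-cond _
        (trans (lefts 6 _) (at₂ (λ w a → bit (lookup (K.P₁ w) a)) ew ea))
        (λ a∈ → builds-imply {y = V w a w′ K′.#A₁} {V w a w′ K′.#A₁} {S w w′} inv
          (denotes-V (var (right , 2)) (rights 2 _) ≤-refl) (denotes-V (var (right , 2)) (rights 2 _) ≤-refl)
          denotes-S refl refl
          -- One round of the game: the simulation answers `a` by `a′`, the completed chain refutes
          -- `a′` by `b′`, and the simulation's own reply `b` contradicts the refutation.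
          λ bad _ R alt r → let a′ , a′∈ , reply  = proj₂ (alt w w′ r) a (lookup⇒[]= a _ a∈)
                                b′ , b′∈ , beaten = bad R alt a′ (toℕ<n a′) a′∈
                                b , b∈ , r′       = reply b′ b′∈
                            in beaten b b∈ r′)
        λ _ → builds-skip inv)

      builds-mark-T : Builds (mark (T# (var w′#) (lit 0))) s 100 (_≡ axiom (code (T w a w′ 0)))
      builds-mark-T = run-≤ (≤ᵇ⇒≤ _ 100 _) (builds-mark {x = T w a w′ 0} inv
        (denotes-T (var w′#) (lit 0) w′ ew′ refl z≤n) λ _ _ _ ())

      builds-mark-V : Builds (mark (V# (lit 0))) s 100 (_≡ axiom (code (V w a w′ 0)))
      builds-mark-V = run-≤ (≤ᵇ⇒≤ _ 100 _) (builds-mark {x = V w a w′ 0} inv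
        (denotes-V (lit 0) refl z≤n) λ _ _ _ ())

  1≤W : 1 ≤ K.#W
  1≤W = Fin⇒1≤ K.ŵ
  1≤W′ : 1 ≤ K′.#W
  1≤W′ = Fin⇒1≤ K′.ŵ
  1≤A₁ : 1 ≤ K.#A₁
  1≤A₁ = Fin⇒1≤ (proj₁ (K.P₁≢∅ K.ŵ))
  1≤A₂ : 1 ≤ K.#A₂
  1≤A₂ = Fin⇒1≤ (proj₁ (K.P₂≢∅ K.ŵ))
  1≤A₁′ : 1 ≤ K′.#A₁
  1≤A₁′ = Fin⇒1≤ (proj₁ (K′.P₁≢∅ K′.ŵ))
  1≤A₂′ : 1 ≤ K′.#A₂
  1≤A₂′ = Fin⇒1≤ (proj₁ (K′.P₂≢∅ K′.ŵ))

  -- `Y` is, up to a constant, the time spent on one triple of `w`, `w′` and `a`: one summand for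
  -- the `V` chain, one for the `T` chain.
  Y Z : ℕ
  Y = K′.#A₁ * K′.#A₂ + K.#A₂
  Z = K.#W * K′.#W * K.#A₁ * Y

  1≤Y : 1 ≤ Y
  1≤Y = ≤-trans 1≤A₂ (m≤n+m _ _)

  module _ {s : Store} {w : Fin K.#W} {w′ : Fin K′.#W} {a : Fin K.#A₁} (inv : Inv s)
           (ew : s (w# , []) ≡ toℕ w) (ew′ : s (w′# , []) ≡ toℕ w′) (ea : s (a# , []) ≡ toℕ a) where

    builds-b-loop : Builds (for b# (left , 3) b-body) s (Y * 414) λ it → ∃[ b ] stepT w w′ a b it
    builds-b-loop = run-≤ (*-monoˡ-≤ 414 (m≤n+m K.#A₂ (K′.#A₁ * K′.#A₂)))
      (builds-for b# (left , 3) b-body refl refl refl (Inv.lefts inv 3 []) 1≤A₂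
        (λ b fr eb inv′ → builds-b-body inv′ (trans (fr _ _ refl) ew) (trans (fr _ _ refl) ew′) (trans (fr _ _ refl) ea) eb)
        inv)

    builds-a′-body : ∀ {a′} → s (a′# , []) ≡ toℕ a′ → Builds a′-body s (K′.#A₂ * 424) (stepV w w′ a a′)
    builds-a′-body {a′} ea′ = run-≤ bound (builds-cond _ avail
      (λ a′∈ → builds-for b′# (right , 3) b′-body refl refl refl (Inv.rights inv 3 []) 1≤A₂′
        (λ b′ fr eb′ inv′ → builds-b′-body inv′ (trans (fr _ _ refl) ew) (trans (fr _ _ refl) ew′) (trans (fr _ _ refl) ea)
          (trans (fr _ _ refl) ea′) (lookup⇒[]= a′ _ a′∈) eb′) inv)
      λ a′∉ → builds-a′-skip inv ew ew′ ea ea′ a′∉)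
      where
      avail : s ((right , 6) , s (w′# , []) ∷ s (a′# , []) ∷ []) ≡ bit (lookup (K′.P₁ w′) a′)
      avail = trans (Inv.rights inv 6 _) (at₂ (λ w a → bit (lookup (K′.P₁ w) a)) ew′ ea′)
      bound : 6 + (K′.#A₂ * (400 + 14) ⊔ 360) ≤ K′.#A₂ * 424
      bound = begin
        6 + (K′.#A₂ * 414 ⊔ 360)   ≤⟨ +-mono-≤ (*-mono-≤ 1≤A₂′ (≤ᵇ⇒≤ 6 10 _)) (⊔-lub ≤-refl (*-mono-≤ 1≤A₂′ (≤ᵇ⇒≤ 360 414 _))) ⟩
        K′.#A₂ * 10 + K′.#A₂ * 414 ≡⟨ sym (*-distribˡ-+ K′.#A₂ 10 414) ⟩
        K′.#A₂ * 424               ∎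
        where open ≤-Reasoning

  builds-a′-loop : ∀ {s w w′ a} → Inv s → s (w# , []) ≡ toℕ w → s (w′# , []) ≡ toℕ w′ → s (a# , []) ≡ toℕ a →
                   Builds (for a′# (right , 2) a′-body) s (Y * 438) λ it → ∃[ a′ ] stepV w w′ a a′ it
  builds-a′-loop inv ew ew′ ea = run-≤ (≤-trans (absorb K′.#A₁ 424 14 1≤A₂′) (*-monoˡ-≤ 438 (m≤m+n (K′.#A₁ * K′.#A₂) K.#A₂)))
    (builds-for a′# (right , 2) a′-body refl refl refl (Inv.rights inv 2 []) 1≤A₁′
      (λ a′ fr ea′ inv′ → builds-a′-body inv′ (trans (fr _ _ refl) ew) (trans (fr _ _ refl) ew′) (trans (fr _ _ refl) ea) ea′)
      inv)

  builds-a-body : ∀ {s w w′ a} → Inv s → s (w# , []) ≡ toℕ w → s (w′# , []) ≡ toℕ w′ → s (a# , []) ≡ toℕ a →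
                  Builds a-body s (Y * 1452) (items-a w w′ a)
  builds-a-body inv ew ew′ ea = run-≤ bound
    (builds-seq (builds-mark-T inv ew ew′ ea) λ fr₁ inv₁ →
     let ew₁ = trans (fr₁ _ _ refl) ew ; ew₁′ = trans (fr₁ _ _ refl) ew′ ; ea₁ = trans (fr₁ _ _ refl) ea in
     builds-seq (builds-mark-V inv₁ ew₁ ew₁′ ea₁) λ fr₂ inv₂ →
     let ew₂ = trans (fr₂ _ _ refl) ew₁ ; ew₂′ = trans (fr₂ _ _ refl) ew₁′ ; ea₂ = trans (fr₂ _ _ refl) ea₁ in
     builds-seq (builds-b-loop inv₂ ew₂ ew₂′ ea₂) λ fr₃ inv₃ →
     let ew₃ = trans (fr₃ _ _ refl) ew₂ ; ew₃′ = trans (fr₃ _ _ refl) ew₂′ ; ea₃ = trans (fr₃ _ _ refl) ea₂ in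
     builds-seq (builds-a′-loop inv₃ ew₃ ew₃′ ea₃) λ fr₄ inv₄ →
     builds-conclude inv₄ (trans (fr₄ _ _ refl) ew₃) (trans (fr₄ _ _ refl) ew₃′) (trans (fr₄ _ _ refl) ea₃))
    where
    bound : 100 + (100 + (Y * 414 + (Y * 438 + 400))) ≤ Y * 1452
    bound = begin
      100 + (100 + (Y * 414 + (Y * 438 + 400))) ≡⟨ lemma Y ⟩
      1 * 600 + Y * 852                         ≤⟨ +-monoˡ-≤ (Y * 852) (*-monoˡ-≤ 600 1≤Y) ⟩
      Y * 600 + Y * 852                         ≡⟨ sym (*-distribˡ-+ Y 600 852) ⟩
      Y * 1452                                  ∎
      where
      open ≤-Reasoning
      lemma : ∀ y → 100 + (100 + (y * 414 + (y * 438 + 400))) ≡ 1 * 600 + y * 852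
      lemma = solve-∀

  builds-build : ∀ {s} → Inv s → Builds build s (Z * 1594) items
  builds-build inv = run-≤ bound (builds-for w# (left , 1) _ refl refl refl (Inv.lefts inv 1 []) 1≤W
    (λ w fr₁ ew inv₁ → builds-for w′# (right , 1) _ refl refl refl (Inv.rights inv₁ 1 []) 1≤W′
      (λ w′ fr₂ ew′ inv₂ → let ew₂ = trans (fr₂ _ _ refl) ew in
        builds-seq (builds-labels inv₂ ew₂ ew′) λ fr₃ inv₃ →
        let ew₃ = trans (fr₃ _ _ refl) ew₂ ; ew₃′ = trans (fr₃ _ _ refl) ew′ in
        builds-for a# (left , 2) a-body refl refl refl (Inv.lefts inv₃ 2 []) 1≤A₁
          (λ a fr₄ ea inv₄ → builds-a-body inv₄ (trans (fr₄ _ _ refl) ew₃) (trans (fr₄ _ _ refl) ew₃′) ea)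
          inv₃)
      inv₁)
    inv)
    where
    open ≤-Reasoning
    X = K.#A₁ * Y
    1≤X : 1 ≤ X
    1≤X = *-mono-≤ 1≤A₁ 1≤Y
    inner : 100 + K.#A₁ * (Y * 1452 + 14) ≤ X * 1566
    inner = begin
      100 + K.#A₁ * (Y * 1452 + 14) ≤⟨ +-mono-≤ (*-monoˡ-≤ 100 1≤X) (absorb K.#A₁ 1452 14 1≤Y) ⟩
      X * 100 + X * 1466            ≡⟨ sym (*-distribˡ-+ X 100 1466) ⟩
      X * 1566                      ∎
    bound : K.#W * (K′.#W * (100 + K.#A₁ * (Y * 1452 + 14) + 14) + 14) ≤ Z * 1594
    bound = begin
      K.#W * (K′.#W * (100 + K.#A₁ * (Y * 1452 + 14) + 14) + 14)
        ≤⟨ *-monoʳ-≤ K.#W (+-monoˡ-≤ 14 (*-monoʳ-≤ K′.#W (+-monoˡ-≤ 14 inner))) ⟩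
      K.#W * (K′.#W * (X * 1566 + 14) + 14)   ≤⟨ *-monoʳ-≤ K.#W (+-monoˡ-≤ 14 (absorb K′.#W 1566 14 1≤X)) ⟩
      K.#W * (K′.#W * X * 1580 + 14)          ≤⟨ absorb K.#W 1580 14 (*-mono-≤ 1≤W′ 1≤X) ⟩
      K.#W * (K′.#W * X) * 1594               ≡⟨ cong (_* 1594) (lemma K.#W K′.#W K.#A₁ Y) ⟩
      Z * 1594                                ∎
      where
      lemma : ∀ a b c d → a * (b * (c * d)) ≡ a * b * c * d
      lemma = solve-∀

  -- Initial states and available actions exist, so all cardinalities are positive and each of the
  -- six is at most `Z`. This is what makes the tables affordable.
  B≤ : B ≤ 10 * Z
  B≤ = begin
    B                                 ≤⟨ +-mono-≤ (+-mono-≤ (+-mono-≤ (+-mono-≤ (+-mono-≤ (+-mono-≤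
                                           W≤ W′≤) A₁≤) A₂≤) A₁′≤) A₂′≤) (*-monoʳ-≤ 4 1≤Z) ⟩
    Z + Z + Z + Z + Z + Z + 4 * Z     ≡⟨ lemma Z ⟩
    10 * Z                            ∎
    where
    open ≤-Reasoning
    lemma : ∀ z → z + z + z + z + z + z + 4 * z ≡ 10 * z
    lemma = solve-∀
    1≤Z : 1 ≤ Z
    1≤Z = *-mono-≤ (*-mono-≤ (*-mono-≤ 1≤W 1≤W′) 1≤A₁) 1≤Y
    WW′≤ : K.#W * K′.#W ≤ Z
    WW′≤ = ≤-trans (≤-*ʳ 1≤A₁) (≤-*ʳ 1≤Y)
    W≤ : K.#W ≤ Z
    W≤ = ≤-trans (≤-*ʳ 1≤W′) WW′≤
    W′≤ : K′.#W ≤ Z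
    W′≤ = ≤-trans (≤-*ˡ 1≤W) WW′≤
    A₁≤ : K.#A₁ ≤ Z
    A₁≤ = ≤-trans (≤-*ˡ (*-mono-≤ 1≤W 1≤W′)) (≤-*ʳ 1≤Y)
    Y≤ : Y ≤ Z
    Y≤ = ≤-*ˡ (*-mono-≤ (*-mono-≤ 1≤W 1≤W′) 1≤A₁)
    A₂≤ : K.#A₂ ≤ Z
    A₂≤ = ≤-trans (m≤n+m _ _) Y≤
    A₁′≤ : K′.#A₁ ≤ Z
    A₁′≤ = ≤-trans (≤-trans (≤-*ʳ 1≤A₂′) (m≤m+n _ _)) Y≤
    A₂′≤ : K′.#A₂ ≤ Z
    A₂′≤ = ≤-trans (≤-trans (≤-*ˡ 1≤A₁′) (m≤m+n _ _)) Y≤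

  module Semantics (D : ℕ → Set) (D? : ∀ u → Dec (D u)) (closed : ∀ it → items it → Closed D it) where

    -- If every available `b` led to a dead pair, the links of the `T` chain would die one after
    -- another up to the last.
    win-b : ∀ w w′ a → ¬ D (code (T w a w′ K.#A₂)) → ∃[ b ] b ∈ˢ K.P₂ w × ¬ D (code (S (K.δ w a b) w′))
    win-b w w′ a = chain (λ n → D (code (T w a w′ n))) _
      (closed _ (w , w′ , inj₂ (a , inj₁ refl))) step
      where
      step : ∀ b → D (code (T w a w′ (toℕ b))) →
             (b ∈ˢ K.P₂ w × ¬ D (code (S (K.δ w a b) w′))) ⊎ D (code (T w a w′ (toℕ b + 1)))
      step b d with lookup (K.P₂ w) b in b∈?
                  | (λ it (r : stepT w w′ a b it) → closed it (w , w′ , inj₂ (a , inj₂ (inj₂ (inj₁ (b , r))))))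
      ... | false | cl = inj₂ (cl _ refl d d)
      ... | true  | cl with D? (code (S (K.δ w a b) w′))
      ...   | yes d′ = inj₂ (cl _ refl d d′)
      ...   | no ¬d′ = inj₁ (lookup⇒[]= b _ b∈? , ¬d′)

    win-a′ : ∀ w w′ a → ¬ D (code (V w a w′ K′.#A₁)) →
             ∃[ a′ ] a′ ∈ˢ K′.P₁ w′ × (∀ b′ → b′ ∈ˢ K′.P₂ w′ → ¬ D (code (T w a (K′.δ w′ a′ b′) K.#A₂)))
    win-a′ w w′ a = chain (λ n → D (code (V w a w′ n))) _
      (closed _ (w , w′ , inj₂ (a , inj₂ (inj₁ refl)))) step
      where
      step : ∀ a′ → D (code (V w a w′ (toℕ a′))) →
             (a′ ∈ˢ K′.P₁ w′ × (∀ b′ → b′ ∈ˢ K′.P₂ w′ → ¬ D (code (T w a (K′.δ w′ a′ b′) K.#A₂)))) ⊎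
             D (code (V w a w′ (toℕ a′ + 1)))
      -- Deciding the next link, not the `T` nodes, avoids a search over `b′`: if the link is alive,
      -- no defeating `b′` can exist.
      step a′ d with D? (code (V w a w′ (toℕ a′ + 1)))
      ... | yes d′ = inj₂ d′
      ... | no ¬d′ with lookup (K′.P₁ w′) a′ in a′∈?
                 | (λ it (r : stepV w w′ a a′ it) → closed it (w , w′ , inj₂ (a , inj₂ (inj₂ (inj₂ (inj₁ (a′ , r)))))))
      ...   | false | cl = contradiction (cl _ refl d d) ¬d′
      ...   | true  | cl = inj₁ (lookup⇒[]= a′ _ a′∈? , λ b′ b′∈ dT → ¬d′
        (cl (rule (code (V w a w′ (toℕ a′))) (code (T w a (K′.δ w′ a′ b′) K.#A₂)) (code (V w a w′ (toℕ a′ + 1))))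
          (b′ , if-true ([]=⇒lookup b′∈) refl) d dT))

    same-label : ∀ w w′ → ¬ D (code (S w w′)) → K.L w ≡ K′.L w′
    same-label w w′ ¬d with K.L w Fin.≟ K′.L w′ | (λ it (r : labelled w w′ it) → closed it (w , w′ , inj₁ r))
    ... | yes eq | _  = eq
    ... | no _   | cl = contradiction (cl _ refl) ¬d

    alive-V : ∀ w w′ a → a ∈ˢ K.P₁ w → ¬ D (code (S w w′)) → ¬ D (code (V w a w′ K′.#A₁))
    alive-V w w′ a a∈ ¬d d = ¬d
      (closed (rule (code (V w a w′ K′.#A₁)) (code (V w a w′ K′.#A₁)) (code (S w w′)))
        (w , w′ , inj₂ (a , inj₂ (inj₂ (inj₂ (inj₂ (if-true ([]=⇒lookup a∈) refl)))))) d d)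

  open Pipeline {K.#W} {K′.#W} refl refl 1≤W 1≤W′ (<⇒≤ W<B) (<⇒≤ W′<B) S (λ _ _ → refl) using (result)

  correct : program from input (encodeATS K) (encodeATS K′) computes IsMaximumAltSim K K′ within (constant * Z)
  correct = run-weaken (≤-reflexive (cong (_* Z) constant-≡)) (λ {s} _ → maximum {s})
    (result build base-expr {Z = Z} 10 1594 refl refl refl (λ _ → builds-build) B≤ (≤-reflexive (*-comm Z 1594))
      (≤-trans (≤-*ʳ 1≤A₁) (≤-*ʳ 1≤Y)))
    where
    maximum : ∀ {s} →
      (∃[ D ] (∀ u → Dec (D u)) × (∀ it → items it → Closed D it) × (∀ x → Fits x → D (code x) → Bad x) ×
        (∀ w w′ → outputRel s w w′ → ¬ D (code (S w w′))) × (∀ w w′ → ¬ D (code (S w w′)) → outputRel s w w′)) →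
      IsMaximumAltSim K K′ (outputRel s)
    maximum {s} (D , D? , closed , sound , alive , out) = simulation , λ R alt {w} {w′} r →
      out w w′ λ d → sound (S w w′) (fits-S w w′) d R alt r
      where
      open Semantics D D? closed
      simulation : IsAltSim K K′ (outputRel s)
      simulation w w′ o = same-label w w′ (alive w w′ o) , λ a a∈ →
        let a′ , a′∈ , alive-T = win-a′ w w′ a (alive-V w w′ a a∈ (alive w w′ o))
        in a′ , a′∈ , λ b′ b′∈ →
           -- The `T` chain is taken at the state reached in `K′`, which does not remember the `a′`
           -- and `b′` leading there.
           let b , b∈ , ¬d = win-b w (K′.δ w′ a′ b′) a (alive-T b′ b′∈)
           in b , b∈ , out _ _ ¬d

-- Transition systems

-- Counts the occurrences of `x` among the first `k` values. Applied to the sources of `R′`, it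
-- numbers the transitions leaving one state, although the list is in arbitrary order.
rank : ∀ {n} → (Fin n → ℕ) → ℕ → ℕ → ℕ
rank {zero}  f k       x = 0
rank {suc n} f zero    x = 0
rank {suc n} f (suc k) x = bit (does (f zero ≟ x)) + rank (f ∘ suc) k x

rank-zero : ∀ {n} (f : Fin n → ℕ) x → rank f 0 x ≡ 0
rank-zero {zero}  f x = refl
rank-zero {suc n} f x = refl

rank-suc : ∀ {n} (f : Fin n → ℕ) j x → rank f (suc (toℕ j)) x ≡ rank f (toℕ j) x + bit (does (f j ≟ x))
rank-suc f zero    x = trans (cong (bit (does (f zero ≟ x)) +_) (rank-zero (f ∘ suc) x)) (+-identityʳ _)
rank-suc f (suc j) x = trans (cong (bit (does (f zero ≟ x)) +_) (rank-suc (f ∘ suc) j x))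
  (sym (+-assoc (bit (does (f zero ≟ x))) _ _))

rank-mono : ∀ {n} (f : Fin n → ℕ) {k l} x → k ≤ l → rank f k x ≤ rank f l x
rank-mono {zero}  f x k≤l       = z≤n
rank-mono {suc n} f x z≤n       = z≤n
rank-mono {suc n} f x (s≤s k≤l) = +-monoʳ-≤ _ (rank-mono (f ∘ suc) x k≤l)

bit≤1 : ∀ b → bit b ≤ 1
bit≤1 true  = ≤-refl
bit≤1 false = z≤n

rank-≤ : ∀ {n} (f : Fin n → ℕ) k x → rank f k x ≤ n
rank-≤ {zero}  f k       x = z≤n
rank-≤ {suc n} f zero    x = z≤n
rank-≤ {suc n} f (suc k) x = +-mono-≤ (bit≤1 (does (f zero ≟ x))) (rank-≤ (f ∘ suc) k x)

rank-hit : ∀ {n} (f : Fin n → ℕ) j {x} → f j ≡ x → rank f (suc (toℕ j)) x ≡ rank f (toℕ j) x + 1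
rank-hit f j {x} eq = trans (rank-suc f j x) (cong (λ b → rank f (toℕ j) x + bit b) (dec-true (f j ≟ x) eq))

rank-miss : ∀ {n} (f : Fin n → ℕ) j {x} → f j ≢ x → rank f (suc (toℕ j)) x ≡ rank f (toℕ j) x
rank-miss f j {x} ne = trans (rank-suc f j x)
  (trans (cong (λ b → rank f (toℕ j) x + bit b) (dec-false (f j ≟ x) ne)) (+-identityʳ _))

rank-< : ∀ {n} (f : Fin n → ℕ) {j k x} → f j ≡ x → toℕ j < k → rank f (toℕ j) x < rank f k x
rank-< f {j} {k} {x} eq j<k = ≤-trans (≤-reflexive (trans (+-comm 1 _) (sym (rank-hit f j eq)))) (rank-mono f x j<k)

-- An occurrence of `x` raises the count, so later occurrences have strictly larger rank.
rank-injective : ∀ {n} (f : Fin n → ℕ) {i j x} → f i ≡ x → f j ≡ x →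
                 rank f (toℕ i) x ≡ rank f (toℕ j) x → i ≡ j
rank-injective f {i} {j} ei ej eq with <-cmp (toℕ i) (toℕ j)
... | tri< i<j _ _ = contradiction eq (<⇒≢ (rank-< f ei i<j))
... | tri≈ _ i≡j _ = toℕ-injective i≡j
... | tri> _ _ j<i = contradiction (sym eq) (<⇒≢ (rank-< f ej j<i))

-- Totality picks an outgoing transition for each state, and the source recovers the state. The work
-- on all pairs of states is thereby absorbed into `K.#W * K′.#R`.
sources-≤ : ∀ {σ} (K : TS σ) → TS.#W K ≤ TS.#R K
sources-≤ K = injective⇒≤ {f = λ w → Any.index (proj₂ (total w))} λ {w} {w′} eq → begin
  w                                                          ≡⟨ cong proj₁ (lookup-index (proj₂ (total w))) ⟩
  proj₁ (List.lookup R (Any.index (proj₂ (total w))))        ≡⟨ cong (proj₁ ∘ List.lookup R) eq ⟩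
  proj₁ (List.lookup R (Any.index (proj₂ (total w′))))       ≡⟨ sym (cong proj₁ (lookup-index (proj₂ (total w′)))) ⟩
  w′                                                         ∎
  where
  open TS K
  open ≡-Reasoning

pattern v#   = work , 29
pattern r#   = work , 30
pattern r′#  = work , 31
pattern len# = work , 32

-- The rules of a transition system

module TSProgram where
  T# : Expr → Expr → Expr → List Expr
  T# v w′ n = lit 1 ∷ v ∷ w′ ∷ n ∷ lit 0 ∷ []

  base-expr : Expr
  base-expr = var (left , 1) ⊕ var (right , 1) ⊕ var (right , 2) ⊕ lit 4

  source′ len′ : Expr
  source′ = (right , 5) ⟦ var r′# ∷ [] ⟧
  len′    = len# ⟦ source′ ∷ [] ⟧

  start-body step-body finish-body : Program
  start-body  = labels 4 ⨾ mark (T# (var w#) (var w′#) (lit 0))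
  step-body   = imply (T# (var v#) source′ len′) (S# (var v#) ((right , 6) ⟦ var r′# ∷ [] ⟧)) (T# (var v#) source′ (len′ ⊕ lit 1))
  finish-body = imply (T# target (var w′#) (len# ⟦ var w′# ∷ [] ⟧)) (T# target (var w′#) (len# ⟦ var w′# ∷ [] ⟧))
                      (S# ((left , 5) ⟦ var r# ∷ [] ⟧) (var w′#))
    where target = (left , 6) ⟦ var r# ∷ [] ⟧

  -- In `toATS` an action is the next state itself, so a `T` node needs only the successor `v` and
  -- can be shared by all its predecessors. `step` accounts for |W|·|R′| and `finish` for |W′|·|R|.
  -- While `step` scans `R′`, `len#` counts the transitions seen so far from each source.
  start step finish : Program
  start  = for w# (left , 1) (for w′# (right , 1) start-body)
  step   = for r′# (right , 2) (for v# (left , 1) step-body ⨾ len# ⟦ source′ ∷ [] ⟧≔ len′ ⊕ lit 1)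
  finish = for r# (left , 2) (for w′# (right , 1) finish-body)

  build : Program
  build = start ⨾ step ⨾ finish

  program : Program
  program = init base-expr ⨾ build ⨾ solve ⨾ report

  abstract
    constant : ℕ
    constant = cost base-expr + 7 * 200 + 1110 * 253 + 94

    constant-≡ : cost base-expr + 7 * 200 + 1110 * 253 + 94 ≡ constant
    constant-≡ = refl

-- Correctness and time for transition systems

module TSCorrect {σ : ℕ} (K K′ : TS σ) where
  open TSProgram
  private
    module K  = TS K
    module K′ = TS K′

  source : Fin K.#R → Fin K.#W
  source r = proj₁ (List.lookup K.R r)
  target : Fin K.#R → Fin K.#W
  target r = proj₂ (List.lookup K.R r)
  source₂ : Fin K′.#R → Fin K′.#W
  source₂ r = proj₁ (List.lookup K′.R r)
  target₂ : Fin K′.#R → Fin K′.#W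
  target₂ r = proj₂ (List.lookup K′.R r)

  before : ℕ → Fin K′.#W → ℕ
  before k w′ = rank (λ r → toℕ (source₂ r)) k (toℕ w′)

  -- T v w′ n is dead when v is alive with none of the first n successors of
  -- w′ in the order of R′, so that the chains of one v have |R′| links in
  -- total.
  data Node : Set where
    S : Fin K.#W → Fin K′.#W → Node
    T : Fin K.#W → Fin K′.#W → ℕ → Node

  digits : Node → List ℕ
  digits (S w w′)   = 0 ∷ toℕ w ∷ toℕ w′ ∷ 0 ∷ 0 ∷ []
  digits (T v w′ n) = 1 ∷ toℕ v ∷ toℕ w′ ∷ n ∷ 0 ∷ []

  digits-injective : ∀ x y → digits x ≡ digits y → x ≡ y
  digits-injective (S _ _) (S _ _) eq with ∷-injective (∷-injectiveʳ eq)
  ... | e₁ , eq′ = cong₂ S (toℕ-injective e₁) (toℕ-injective (∷-injectiveˡ eq′))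
  digits-injective (T v w n) (T v′ w′ n′) eq
    with toℕ-injective {i = v} {v′} (∷-injectiveˡ (∷-injectiveʳ eq))
       | toℕ-injective {i = w} {w′} (∷-injectiveˡ (∷-injectiveʳ (∷-injectiveʳ eq)))
       | ∷-injectiveˡ (∷-injectiveʳ (∷-injectiveʳ (∷-injectiveʳ eq)))
  ... | refl | refl | refl = refl
  digits-injective (S _ _) (T _ _ _) ()
  digits-injective (T _ _ _) (S _ _) ()

  length-digits : ∀ x → length (digits x) ≡ 5
  length-digits (S _ _)   = refl
  length-digits (T _ _ _) = refl

  -- The reply is a transition rather than a state, so that its position in the chain is available.
  Bad : Node → Set₁
  Bad (S w w′)   = ∀ P → IsAltSim (toATS K) (toATS K′) P → ¬ P w w′
  Bad (T v w′ n) = ∀ P → IsAltSim (toATS K) (toATS K′) P → ∀ r → source₂ r ≡ w′ → before (toℕ r) w′ < n → ¬ P v (target₂ r)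

  B : ℕ
  B = K.#W + K′.#W + K′.#R + 4

  open Generation (encodeTS K) (encodeTS K′) B digits (λ {x} {y} → digits-injective x y) length-digits Bad

  1<B : 1 < B
  1<B = ≤-trans (s≤s (s≤s z≤n)) (m≤n+m 4 _)
  0<B : 0 < B
  0<B = <⇒≤ 1<B
  W<B : K.#W < B
  W<B = <+4 (m≤n⇒m≤n+o _ (m≤m+n _ _))
  W′<B : K′.#W < B
  W′<B = <+4 (m≤n⇒m≤n+o _ (m≤n+m _ K.#W))
  R′<B : K′.#R < B
  R′<B = <+4 (m≤n+m _ (K.#W + K′.#W))

  fits-S : ∀ w w′ → Fits (S w w′)
  fits-S w w′ = 0<B ∷ <-trans (toℕ<n w) W<B ∷ <-trans (toℕ<n w′) W′<B ∷ 0<B ∷ 0<B ∷ []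

  fits-T : ∀ v w′ {n} → n ≤ K′.#R → Fits (T v w′ n)
  fits-T v w′ n≤ = 1<B ∷ <-trans (toℕ<n v) W<B ∷ <-trans (toℕ<n w′) W′<B ∷ ≤-<-trans n≤ R′<B ∷ 0<B ∷ []

  labelled : Fin K.#W → Fin K′.#W → Item → Set
  labelled w w′ it = if does (K.L w Fin.≟ K′.L w′) then ⊥ else it ≡ axiom (code (S w w′))

  started stepped finished items : Item → Set
  started it  = ∃[ w ] ∃[ w′ ] (labelled w w′ ∪ (_≡ axiom (code (T w w′ 0)))) it
  stepped it  = ∃[ r ] ∃[ v ] it ≡ rule (code (T v (source₂ r) (before (toℕ r) (source₂ r)))) (code (S v (target₂ r)))
                                        (code (T v (source₂ r) (before (toℕ r) (source₂ r) + 1)))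
  finished it = ∃[ r ] ∃[ w′ ] it ≡ rule (code (T (target r) w′ (before K′.#R w′))) (code (T (target r) w′ (before K′.#R w′)))
                                         (code (S (source r) w′))
  items = started ∪ (stepped ∪ finished)

  denotes-S : ∀ s e e′ w w′ → eval s e ≡ toℕ w → eval s e′ ≡ toℕ w′ → Denotes s (S# e e′) (S w w′)
  denotes-S s e e′ w w′ ew ew′ = cong₂ (λ i j → 0 ∷ i ∷ j ∷ 0 ∷ 0 ∷ []) ew ew′ , fits-S w w′

  denotes-T : ∀ s e e′ e″ v w′ {n} → eval s e ≡ toℕ v → eval s e′ ≡ toℕ w′ → eval s e″ ≡ n → n ≤ K′.#R →
              Denotes s (T# e e′ e″) (T v w′ n)
  denotes-T s e e′ e″ v w′ ev ew en n≤ = trans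
    (cong₂ (λ i j → 1 ∷ i ∷ j ∷ eval s e″ ∷ 0 ∷ []) ev ew)
    (cong (λ i → 1 ∷ toℕ v ∷ toℕ w′ ∷ i ∷ 0 ∷ []) en) , fits-T v w′ n≤

  builds-start-body : ∀ {s w w′} → Inv s → s (w# , []) ≡ toℕ w → s (w′# , []) ≡ toℕ w′ →
                      Builds start-body s 200 (labelled w w′ ∪ (_≡ axiom (code (T w w′ 0))))
  builds-start-body {s} {w} {w′} inv ew ew′ = run-≤ (≤ᵇ⇒≤ _ 200 _)
    (builds-seq
      (builds-cond _ (trans (cong₂ (λ l l′ → 1 ∸ ((l ∸ l′) + (l′ ∸ l))) eL eL′) (≢-test (K.L w) (K′.L w′)))
        (λ _ → builds-skip inv)
        (λ ≢ → builds-mark {es = S# (var w#) (var w′#)} {x = S w w′} inv (denotes-S s (var w#) (var w′#) w w′ ew ew′) λ P alt p →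
          case trans (sym ≢) (dec-true (K.L w Fin.≟ K′.L w′) (proj₁ (alt w w′ p))) of λ ()))
      λ {s′} fr inv′ → builds-mark {x = T w w′ 0} inv′
        (denotes-T s′ (var w#) (var w′#) (lit 0) w w′ (trans (fr _ _ refl) ew) (trans (fr _ _ refl) ew′) refl z≤n)
        λ _ _ _ _ ())
    where
    eL : s ((left , 4) , s (w# , []) ∷ []) ≡ toℕ (K.L w)
    eL = trans (Inv.lefts inv 4 _) (at₁ (λ w → toℕ (K.L w)) ew)
    eL′ : s ((right , 4) , s (w′# , []) ∷ []) ≡ toℕ (K′.L w′)
    eL′ = trans (Inv.rights inv 4 _) (at₁ (λ w → toℕ (K′.L w)) ew′)

  Lengths : ℕ → Store → Set
  Lengths k s = ∀ w′ → s (len# , toℕ w′ ∷ []) ≡ before k w′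

  -- A transition counted by the new link but not by the old one has the rank and the source of `r`,
  -- hence is `r`.
  bad-step : ∀ v r → Bad (T v (source₂ r) (before (toℕ r) (source₂ r))) → Bad (S v (target₂ r)) →
             Bad (T v (source₂ r) (before (toℕ r) (source₂ r) + 1))
  bad-step v r bad bad′ P alt q eq q< with before (toℕ q) (source₂ r) ≟ before (toℕ r) (source₂ r)
  ... | no ≢  = bad P alt q eq (≤∧≢⇒< (s≤s⁻¹ (subst (before (toℕ q) (source₂ r) <_) (+-comm _ 1) q<)) ≢)
  ... | yes ≡ with rank-injective (λ r → toℕ (source₂ r)) {q} {r} (cong toℕ eq) refl ≡
  ...   | refl = bad′ P alt

  before-< : ∀ r → before (toℕ r) (source₂ r) + 1 ≤ K′.#R
  before-< r = ≤-trans (≤-reflexive (sym (rank-hit (λ r → toℕ (source₂ r)) r refl)))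
    (rank-≤ (λ r → toℕ (source₂ r)) (suc (toℕ r)) (toℕ (source₂ r)))

  source′-≡ : ∀ {s r} → Inv s → s (r′# , []) ≡ toℕ r → eval s source′ ≡ toℕ (source₂ r)
  source′-≡ inv er = trans (Inv.rights inv 5 _) (at₁ (λ r → toℕ (source₂ r)) er)

  len′-≡ : ∀ {s r} → Inv s → s (r′# , []) ≡ toℕ r → Lengths (toℕ r) s → eval s len′ ≡ before (toℕ r) (source₂ r)
  len′-≡ {s} {r} inv er len = trans (cong (λ w → s (len# , w ∷ [])) (source′-≡ inv er)) (len (source₂ r))

  builds-step-body : ∀ {s r v} → Inv s → Lengths (toℕ r) s → s (r′# , []) ≡ toℕ r → s (v# , []) ≡ toℕ v →
    Builds step-body s 400 (_≡ rule (code (T v (source₂ r) (before (toℕ r) (source₂ r)))) (code (S v (target₂ r)))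
                                    (code (T v (source₂ r) (before (toℕ r) (source₂ r) + 1))))
  builds-step-body {s} {r} {v} inv len er ev = run-≤ (≤ᵇ⇒≤ _ 400 _)
    (builds-imply {y = T v w′ n} {S v (target₂ r)} {T v w′ (n + 1)} inv
      (denotes-T s (var v#) source′ len′ v w′ ev (source′-≡ inv er) (len′-≡ inv er len) (≤-trans (m≤m+n n 1) (before-< r)))
      (denotes-S s (var v#) ((right , 6) ⟦ var r′# ∷ [] ⟧) v (target₂ r) ev
        (trans (Inv.rights inv 6 _) (at₁ (λ r → toℕ (target₂ r)) er)))
      (denotes-T s (var v#) source′ (len′ ⊕ lit 1) v w′ ev (source′-≡ inv er) (cong (_+ 1) (len′-≡ inv er len)) (before-< r))
      refl refl (bad-step v r))
    where
    w′ = source₂ r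
    n  = before (toℕ r) w′

  builds-finish-body : ∀ {s r w′} → Inv s → Lengths K′.#R s → s (r# , []) ≡ toℕ r → s (w′# , []) ≡ toℕ w′ →
    Builds finish-body s 400 (_≡ rule (code (T (target r) w′ (before K′.#R w′))) (code (T (target r) w′ (before K′.#R w′)))
                                      (code (S (source r) w′)))
  builds-finish-body {s} {r} {w′} inv len er ew = run-≤ (≤ᵇ⇒≤ _ 400 _)
    (builds-imply {y = T (target r) w′ n} {T (target r) w′ n} {S (source r) w′} inv den den
      (denotes-S s ((left , 5) ⟦ var r# ∷ [] ⟧) (var w′#) (source r) w′ (trans (Inv.lefts inv 5 _) (at₁ (λ r → toℕ (source r)) er)) ew)
      refl refl
      λ bad _ P alt p →
        -- The answer `v′` is an edge of `K′`; its index in `R′` has rank below the out-degree, so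
        -- the completed chain covers it. Agent 2 has the single action `zero`.
        let v′ , v′∈ , reply = proj₂ (alt (source r) w′ p) (target r) (∈-post⁺ K (∈-lookup r))
            _ , _ , p′ = reply zero ∈⊤
            edge = ∈-post⁻ K′ v′∈
            q = Any.index edge
            eq : (w′ , v′) ≡ List.lookup K′.R q
            eq = lookup-index edge
        in bad P alt q (sym (cong proj₁ eq)) (rank-< (λ r → toℕ (source₂ r)) (cong toℕ (sym (cong proj₁ eq))) (toℕ<n q))
             (subst (P (target r)) (cong proj₂ eq) p′))
    where
    n = before K′.#R w′
    den : Denotes s (T# ((left , 6) ⟦ var r# ∷ [] ⟧) (var w′#) (len# ⟦ var w′# ∷ [] ⟧)) (T (target r) w′ n)
    den = denotes-T s ((left , 6) ⟦ var r# ∷ [] ⟧) (var w′#) (len# ⟦ var w′# ∷ [] ⟧) (target r) w′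
      (trans (Inv.lefts inv 6 _) (at₁ (λ r → toℕ (target r)) er)) ew
      (trans (cong (λ w → s (len# , w ∷ [])) ew) (len w′)) (rank-≤ _ K′.#R (toℕ w′))

  1≤W : 1 ≤ K.#W
  1≤W = Fin⇒1≤ K.ŵ
  1≤W′ : 1 ≤ K′.#W
  1≤W′ = Fin⇒1≤ K′.ŵ
  1≤R : 1 ≤ K.#R
  1≤R = ≤-trans 1≤W (sources-≤ K)
  1≤R′ : 1 ≤ K′.#R
  1≤R′ = ≤-trans 1≤W′ (sources-≤ K′)

  Z : ℕ
  Z = K.#W * K′.#R + K′.#W * K.#R

  WR′≤Z : K.#W * K′.#R ≤ Z
  WR′≤Z = m≤m+n _ _
  W′R≤Z : K′.#W * K.#R ≤ Z
  W′R≤Z = m≤n+m (K′.#W * K.#R) (K.#W * K′.#R)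
  WW′≤Z : K.#W * K′.#W ≤ Z
  WW′≤Z = ≤-trans (*-monoʳ-≤ K.#W (sources-≤ K′)) WR′≤Z

  builds-start : ∀ {s} → Inv s → Builds start s (Z * 228) started
  builds-start inv = run-≤ bound (builds-for w# (left , 1) _ refl refl refl (Inv.lefts inv 1 []) 1≤W
    (λ w fr₁ ew inv₁ → builds-for w′# (right , 1) start-body refl refl refl (Inv.rights inv₁ 1 []) 1≤W′
      (λ w′ fr₂ ew′ inv₂ → builds-start-body inv₂ (trans (fr₂ _ _ refl) ew) ew′) inv₁) inv)
    where
    bound : K.#W * (K′.#W * (200 + 14) + 14) ≤ Z * 228
    bound = ≤-trans (absorb K.#W 214 14 1≤W′) (*-monoˡ-≤ 228 WW′≤Z)

  builds-step : ∀ {s} → Inv s → Lengths 0 s →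
                Run step s (Z * 454) λ s′ → Post s stepped s′ × Lengths K′.#R s′
  builds-step {s₀} inv len = run-≤ bound (builds-for-with r′# (right , 2) _ Lengths refl refl refl (Inv.rights inv 2 []) 1≤R′ id
    (λ r {s} fr er inv₁ len₁ → run-seq
      (builds-for v# (left , 1) step-body refl refl refl (Inv.lefts inv₁ 1 []) 1≤W
        (λ v fr₂ ev inv₂ → builds-step-body inv₂ (λ w → trans (fr₂ _ _ refl) (len₁ w)) (trans (fr₂ _ _ refl) er) ev) inv₁)
      λ {s₁} fr₁ (inv₂ , mono , has) → run-assign
        ( ( inv-resp (scratch-update s₁ refl) inv₂
          , (λ it → holds-resp (scratch-update s₁ refl) it ∘ mono it)
          , (λ it → holds-resp (scratch-update s₁ refl) it ∘ has it))
        , extend r s₁ inv₂ (trans (fr₁ _ _ refl) er) (λ w → trans (fr₁ _ _ refl) (len₁ w))))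
    inv len)
    where
    extend : ∀ r s₁ → Inv s₁ → s₁ (r′# , []) ≡ toℕ r → Lengths (toℕ r) s₁ →
             Lengths (suc (toℕ r)) (s₁ [ len# , eval s₁ source′ ∷ [] ↦ eval s₁ len′ + 1 ])
    extend r s₁ inv₁ er len₁ w with source₂ r Fin.≟ w
    ... | yes refl = trans (cong (λ i → (s₁ [ cell ↦ eval s₁ len′ + 1 ]) (len# , i ∷ [])) (sym (source′-≡ inv₁ er)))
      (trans (update-same s₁ cell) (trans (cong (_+ 1) (len′-≡ inv₁ er len₁))
        (sym (rank-hit (λ r → toℕ (source₂ r)) r refl))))
      where cell = len# , eval s₁ source′ ∷ []
    ... | no ≢w = trans (update-other s₁ (len# , eval s₁ source′ ∷ []) (≢-index λ eq → ≢w (toℕ-injective (sym (trans eq (source′-≡ inv₁ er))))))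
      (trans (len₁ w) (sym (rank-miss (λ r → toℕ (source₂ r)) r (≢w ∘ toℕ-injective))))
    open ≤-Reasoning
    -- 12 is the cost of updating `len#` after the inner loop.
    bound : K′.#R * (K.#W * (400 + 14) + 12 + 14) ≤ Z * 454
    bound = begin
      K′.#R * (K.#W * 414 + 12 + 14)  ≡⟨ cong (K′.#R *_) (+-assoc (K.#W * 414) 12 14) ⟩
      K′.#R * (K.#W * 414 + 26)       ≤⟨ absorb K′.#R 414 26 1≤W ⟩
      K′.#R * K.#W * 440              ≤⟨ *-mono-≤ (≤-trans (≤-reflexive (*-comm K′.#R K.#W)) WR′≤Z) (≤ᵇ⇒≤ 440 454 _) ⟩
      Z * 454                         ∎

  builds-finish : ∀ {s} → Inv s → Lengths K′.#R s → Builds finish s (Z * 428) finished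
  builds-finish inv len = run-≤ bound (builds-for r# (left , 2) _ refl refl refl (Inv.lefts inv 2 []) 1≤R
    (λ r fr₁ er inv₁ → builds-for w′# (right , 1) finish-body refl refl refl (Inv.rights inv₁ 1 []) 1≤W′
      (λ w′ fr₂ ew inv₂ → builds-finish-body inv₂ (λ w → trans (fr₂ _ _ refl) (trans (fr₁ _ _ refl) (len w)))
        (trans (fr₂ _ _ refl) er) ew) inv₁) inv)
    where
    bound : K.#R * (K′.#W * (400 + 14) + 14) ≤ Z * 428
    bound = ≤-trans (absorb K.#R 414 14 1≤W′) (*-monoˡ-≤ 428 (≤-trans (≤-reflexive (*-comm K.#R K′.#W)) W′R≤Z))

  builds-build : ∀ {s} → Frame (init base-expr) (input (encodeTS K) (encodeTS K′)) s → Inv s → Builds build s (Z * 1110) items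
  builds-build fr₀ inv = run-≤ (≤-reflexive (lemma Z))
    (builds-seq (builds-start inv) λ fr₁ inv₁ →
     builds-seq-with
       (builds-step inv₁ λ w → trans (fr₁ _ _ refl) (trans (fr₀ _ _ refl) (sym (rank-zero (λ r → toℕ (source₂ r)) (toℕ w)))))
       λ _ inv₂ len → builds-finish inv₂ len)
    where
    lemma : ∀ z → z * 228 + (z * 454 + z * 428) ≡ z * 1110
    lemma = solve-∀

  B≤ : B ≤ 7 * Z
  B≤ = begin
    B                      ≤⟨ +-mono-≤ (+-mono-≤ (+-mono-≤ W≤ W′≤) R′≤) (*-monoʳ-≤ 4 1≤Z) ⟩
    Z + Z + Z + 4 * Z      ≡⟨ lemma Z ⟩
    7 * Z                  ∎
    where
    open ≤-Reasoning
    lemma : ∀ z → z + z + z + 4 * z ≡ 7 * z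
    lemma = solve-∀
    1≤Z : 1 ≤ Z
    1≤Z = ≤-trans (*-mono-≤ 1≤W 1≤R′) WR′≤Z
    W≤ : K.#W ≤ Z
    W≤ = ≤-trans (≤-*ʳ 1≤R′) WR′≤Z
    W′≤ : K′.#W ≤ Z
    W′≤ = ≤-trans (≤-*ʳ 1≤R) W′R≤Z
    R′≤ : K′.#R ≤ Z
    R′≤ = ≤-trans (≤-*ˡ 1≤W) WR′≤Z

  module Semantics (D : ℕ → Set) (D? : ∀ u → Dec (D u)) (closed : ∀ it → items it → Closed D it) where

    same-label : ∀ w w′ → ¬ D (code (S w w′)) → K.L w ≡ K′.L w′
    same-label w w′ ¬d with K.L w Fin.≟ K′.L w′ | (λ it (r : labelled w w′ it) → closed it (inj₁ (w , w′ , inj₁ r)))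
    ... | yes eq | _  = eq
    ... | no _   | cl = contradiction (cl _ refl) ¬d

    -- The chain is walked along all of `R′`: a transition with another source leaves the count, and
    -- therefore the node, unchanged.
    win : ∀ v w′ → ¬ D (code (T v w′ (before K′.#R w′))) → ∃[ r ] source₂ r ≡ w′ × ¬ D (code (S v (target₂ r)))
    win v w′ = chain (λ k → D (code (T v w′ (before k w′)))) _
      (subst (λ n → D (code (T v w′ n))) (sym (rank-zero (λ r → toℕ (source₂ r)) (toℕ w′))) (closed _ (inj₁ (v , w′ , inj₂ refl))))
      step′
      where
      step′ : ∀ r → D (code (T v w′ (before (toℕ r) w′))) →
             (source₂ r ≡ w′ × ¬ D (code (S v (target₂ r)))) ⊎ D (code (T v w′ (before (toℕ r + 1) w′)))
      step′ r d with source₂ r Fin.≟ w′ | D? (code (S v (target₂ r)))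
      ... | no ≢w′   | _      = inj₂ (subst (λ n → D (code (T v w′ n)))
        (trans (sym (rank-miss (λ r → toℕ (source₂ r)) r (≢w′ ∘ toℕ-injective))) (cong (λ k → before k w′) (+-comm 1 (toℕ r)))) d)
      ... | yes refl | yes d′ = inj₂ (subst (λ n → D (code (T v w′ n)))
        (trans (sym (rank-hit (λ r → toℕ (source₂ r)) r refl)) (cong (λ k → before k w′) (+-comm 1 (toℕ r))))
        (closed _ (inj₂ (inj₁ (r , v , refl))) d d′))
      ... | yes eq   | no ¬d′ = inj₁ (eq , ¬d′)

    -- The contrapositive of the rule that `finish` stores for this edge and `w′`.
    alive-T : ∀ w v w′ → (w , v) ∈ K.R → ¬ D (code (S w w′)) → ¬ D (code (T v w′ (before K′.#R w′)))
    alive-T w v w′ edge ¬d d = ¬d (subst (λ w → D (code (S w w′))) (sym (cong proj₁ eq))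
      (closed _ (inj₂ (inj₂ (Any.index edge , w′ , refl))) d′ d′))
      where
      eq : (w , v) ≡ List.lookup K.R (Any.index edge)
      eq = lookup-index edge
      d′ = subst (λ v → D (code (T v w′ (before K′.#R w′)))) (cong proj₂ eq) d

  open Pipeline {K.#W} {K′.#W} refl refl 1≤W 1≤W′ (<⇒≤ W<B) (<⇒≤ W′<B) S (λ _ _ → refl) using (result)

  correct : program from input (encodeTS K) (encodeTS K′) computes IsMaximumAltSim (toATS K) (toATS K′) within (constant * Z)
  correct = run-weaken (≤-reflexive (cong (_* Z) constant-≡)) (λ {s} _ → maximum {s})
    (result build base-expr {Z = Z} 7 1110 refl refl refl builds-build B≤ (≤-reflexive (*-comm Z 1110)) WW′≤Z)
    where
    maximum : ∀ {s} →
      (∃[ D ] (∀ u → Dec (D u)) × (∀ it → items it → Closed D it) × (∀ x → Fits x → D (code x) → Bad x) ×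
        (∀ w w′ → outputRel s w w′ → ¬ D (code (S w w′))) × (∀ w w′ → ¬ D (code (S w w′)) → outputRel s w w′)) →
      IsMaximumAltSim (toATS K) (toATS K′) (outputRel s)
    maximum {s} (D , D? , closed , sound , alive , out) = simulation , λ P alt {w} {w′} p →
      out w w′ λ d → sound (S w w′) (fits-S w w′) d P alt p
      where
      open Semantics D D? closed
      simulation : IsAltSim (toATS K) (toATS K′) (outputRel s)
      simulation w w′ o = same-label w w′ (alive w w′ o) , λ v v∈ →
        let r , eq , ¬d = win v w′ (alive-T w v w′ (∈-post⁻ K v∈) (alive w w′ o))
        in target₂ r , ∈-post⁺ K′ (subst (λ w → (w , target₂ r) ∈ K′.R) eq (∈-lookup r)) ,
           λ _ _ → zero , ∈⊤ , out v (target₂ r) ¬d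

theorem5 :
    (∃[ p ] ∃[ c ] ∀ {σ : ℕ} (K K′ : ATS σ) →
      let module K = ATS K
          module K′ = ATS K′
      in p from input (encodeATS K) (encodeATS K′)
           computes IsMaximumAltSim K K′
           within (c * (K.#W * K′.#W * K.#A₁ * (K′.#A₁ * K′.#A₂ + K.#A₂)
                        + K.#W ^ 2 * K.#A₁ + K′.#W ^ 2 * K′.#A₁)))
    ×
    (∃[ p ] ∃[ c ] ∀ {σ : ℕ} (K K′ : TS σ) →
      let module K = TS K
          module K′ = TS K′
      in p from input (encodeTS K) (encodeTS K′)
           computes IsMaximumAltSim (toATS K) (toATS K′)
           within (c * (K.#W * K′.#R + K′.#W * K.#R)))
theorem5 =
  (ATSProgram.program , ATSProgram.constant , λ K K′ → run-≤
    (*-monoʳ-≤ ATSProgram.constant (≤-trans (m≤m+n (ATSCorrect.Z K K′) _) (m≤m+n _ _))) (ATSCorrect.correct K K′)) ,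
  (TSProgram.program , TSProgram.constant , TSCorrect.correct)
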